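{- Let $\mathcal{P}_2(z)=\sum_{n\ge 0} |\mathcal{S}_n\cap Av(\mathbf{4123},\mathbf{1243})|\, z^n$ be the generating function for the permutation class $Av(\mathbf{4123},\mathbf{1243})$. Then $$\mathcal{P}_2(z) = \frac{2-8z+2z^2+17z^3-15z^4+4z^5-(2-10z+16z^2-9z^3+2z^4)\sqrt{1-6z+5z^2}}{2z(2-z)^2(1-2z)(1-3z+z^2)}.$$
   Context: A permutation $\sigma$ contains a pattern $\pi$ if some subsequence of $\sigma$ is order-isomorphic to $\pi$; otherwise $\sigma$ avoids $\pi$. For a set $B$ of patterns, $Av(B)$ is the set of permutations avoiding every element of $B$, and $\mathcal{S}_n$ is the set of permutations of length $n$ (the empty permutation is counted for $n=0$). -}

module Defs where

open import Data.Nat using (ℕ; zero; suc; _<ᵇ_; _≡ᵇ_)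
open import Data.Bool using (Bool; true; false; _∧_; not; if_then_else_)
open import Data.List using (List; []; _∷_; length; map; filter; upTo; concatMap; zip; _++_)
open import Data.Bool.ListAction using (all; any)
open import Data.Integer using (ℤ; +_; -[1+_]) renaming (_+_ to _+ℤ_; _*_ to _*ℤ_; -_ to -ℤ_)
open import Data.Product using (_,_)
open import Relation.Binary.PropositionalEquality using (_≡_)
open import Relation.Nullary.Decidable using (does)
open import Data.Bool.Properties using () renaming (_≟_ to _≟ᵇ_)

-- Permutations of length n are represented as lists (one-line notation)
-- of the values 0 … n-1, each occurring exactly once.

words : ℕ → ℕ → List (List ℕ)
words zero    n = [] ∷ []
words (suc k) n = concatMap (λ w → map (λ a → a ∷ w) (upTo n)) (words k n)

boundedᵇ : ℕ → List ℕ → Bool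
boundedᵇ n = all (λ x → x <ᵇ n)

distinctᵇ : List ℕ → Bool
distinctᵇ []       = true
distinctᵇ (x ∷ xs) = all (λ y → not (x ≡ᵇ y)) xs ∧ distinctᵇ xs

isPermᵇ : ℕ → List ℕ → Bool
isPermᵇ n w = (length w ≡ᵇ n) ∧ boundedᵇ n w ∧ distinctᵇ w

subseqs : List ℕ → List (List ℕ)
subseqs []       = [] ∷ []
subseqs (x ∷ xs) = map (x ∷_) (subseqs xs) ++ subseqs xs

-- order-isomorphism of two sequences of distinct entries:
-- same length, and for all positions i < j, (u_i < u_j) iff (v_i < v_j)
orderIsoᵇ : List ℕ → List ℕ → Bool
orderIsoᵇ []       []       = true
orderIsoᵇ []       (_ ∷ _)  = false
orderIsoᵇ (_ ∷ _)  []       = false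
orderIsoᵇ (x ∷ xs) (y ∷ ys) =
  (length xs ≡ᵇ length ys)
  ∧ all (λ p → does ((x <ᵇ Data.Product.proj₁ p) ≟ᵇ (y <ᵇ Data.Product.proj₂ p))) (zip xs ys)
  ∧ orderIsoᵇ xs ys
  where import Data.Product

containsᵇ : List ℕ → List ℕ → Bool
containsᵇ σ π = any (orderIsoᵇ π) (subseqs σ)

avoidsᵇ : List (List ℕ) → List ℕ → Bool
avoidsᵇ B σ = all (λ π → not (containsᵇ σ π)) B

-- |S_n ∩ Av(B)|  (for n = 0 the empty permutation is counted)
countAv : List (List ℕ) → ℕ → ℕ
countAv B n = length (filter (λ w → (isPermᵇ n w ∧ avoidsᵇ B w) ≟ᵇ true) (words n n))

-- the patterns 4123 and 1243 (written 0-based, order-isomorphic)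
p4123 : List ℕ
p4123 = 3 ∷ 0 ∷ 1 ∷ 2 ∷ []

p1243 : List ℕ
p1243 = 0 ∷ 1 ∷ 3 ∷ 2 ∷ []

PS : Set
PS = ℕ → ℤ

sumTo : ℕ → (ℕ → ℤ) → ℤ
sumTo zero    f = f zero
sumTo (suc n) f = sumTo n f +ℤ f (suc n)

_⊛_ : PS → PS → PS
(f ⊛ g) n = sumTo n (λ k → f k *ℤ g (n Data.Nat.∸ k))

infixl 7 _⊛_

_⊕_ : PS → PS → PS
(f ⊕ g) n = f n +ℤ g n

infixl 6 _⊕_

_⊖_ : PS → PS → PS
(f ⊖ g) n = f n +ℤ (-ℤ g n)

infixl 6 _⊖_

poly : List ℤ → PS
poly []       n       = + 0
poly (c ∷ cs) zero    = c
poly (c ∷ cs) (suc n) = poly cs n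

_≋_ : PS → PS → Set
f ≋ g = ∀ n → f n ≡ g n

infix 4 _≋_

P₂ : PS
P₂ n = + countAv (p4123 ∷ p1243 ∷ []) n

{-# OPTIONS --safe #-}
module Submission where

-- Build the permutations by inserting successive maxima. A position of w is dead when the suffix
-- after it contains 123, or when some 12 before it is followed by a larger entry after it.
-- Inserting a maximum at s leaves every position to the right of s as it was, while a live position
-- t ≤ s survives exactly when neither the entries before t nor those between t and s contain 12.
-- Hence only the first two descending runs of w matter, and the number of descendants of w depends
-- on at most three numbers: the live positions inside the first run, inside the second run, and
-- after both.
--
-- The resulting linear system for the generating functions has a unique solution. With
-- u = 1/(1 − z) and M = u + z M², its solution is, up to a common polynomial factor, an explicit
-- combination of powers of u and M; the square root enters through 2z(1 − z)M = 1 − z − S.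

open import Data.List using (List; []; _∷_)
open import Data.Integer using (ℤ; +_; -[1+_])
open import Relation.Binary.PropositionalEquality using (_≡_)
open import Defs

open import Algebra.Bundles using (CommutativeRing; RawRing)
open import Algebra.Solver.Ring.AlmostCommutativeRing
  using (AlmostCommutativeRing; fromCommutativeRing; _-Raw-AlmostCommutative⟶_)
import Algebra.Solver.Ring
open import Data.Bool using (Bool; true; false; _∧_; not; if_then_else_)
open import Data.Bool.ListAction using (any; all)
import Data.Bool.Properties as 𝔹ₚ
open import Data.Integer using () renaming (_+_ to _+ℤ_; _*_ to _*ℤ_; -_ to -ℤ_)
import Data.Integer.Properties as ℤₚ
open import Data.Integer.Tactic.RingSolver using (solve-∀)
open import Data.List using (_++_; _ʳ++_; length; map; concatMap; filter; upTo)
import Data.List.Properties as Listₚ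
open import Data.List.Membership.DecPropositional using (_∈?_)
open import Data.List.Membership.Propositional using (_∈_; _∉_; lose; find)
open import Data.List.Membership.Propositional.Properties
  using (∈-++⁺ˡ; ∈-++⁺ʳ; ∈-++⁻; ∈-map⁺; ∈-map⁻; ∈-concatMap⁺; ∈-concatMap⁻; ∈-filter⁺; ∈-filter⁻; ∈-∃++; ∈-upTo⁺)
open import Data.List.Membership.Propositional.Properties.WithK using (unique∧set⇒bag)
open import Data.List.Relation.Binary.BagAndSetEquality using (∼bag⇒↭)
open import Data.List.Relation.Binary.Permutation.Propositional using (_↭_; ↭-sym; ↭⇒↭ₛ)
open import Data.List.Relation.Binary.Permutation.Propositional.Properties using (shift; ↭-length; All-resp-↭)
import Data.List.Relation.Binary.Permutation.Setoid.Properties as ↭ₛ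
open import Data.List.Relation.Binary.Sublist.Propositional using (_⊆_; []; _∷_; _∷ʳ_; ⊆-refl; ⊆-trans; minimum)
open import Data.List.Relation.Binary.Sublist.Propositional.Properties using (All-resp-⊆; ʳ++⁺; ++⁺; ++⁺ˡ; ++⁺ʳ)
open import Data.List.Relation.Unary.All as All using (All; []; _∷_)
import Data.List.Relation.Unary.All.Properties as Allₚ
open import Data.List.Relation.Unary.AllPairs using ([]; _∷_)
open import Data.List.Relation.Unary.Any using (here; there)
open import Data.List.Relation.Unary.Unique.Propositional using (Unique)
import Data.List.Relation.Unary.Unique.Propositional.Properties as Uniqueₚ
open import Data.Maybe using (Maybe; nothing; just)
open import Data.Nat as ℕ using (ℕ; zero; suc; _∸_; _≤_; _<_; _<ᵇ_; _≡ᵇ_; z≤n; s≤s)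
open import Data.Nat.ListAction using (sum)
open import Data.Nat.ListAction.Properties using (sum-++)
import Data.Nat.Properties as ℕₚ
open import Data.Product using (_×_; _,_; ∃; ∃₂; proj₁; proj₂)
open import Data.Sum using (_⊎_; inj₁; inj₂; [_,_]′)
open import Data.Unit using (⊤; tt)
open import Function using (_∘_; mk⇔)
open import Function.Bundles using (Equivalence)
open import Level using (0ℓ)
import Relation.Binary.PropositionalEquality as ≡
open import Relation.Nullary using (¬_; yes; no; does; contradiction)

-- Generating tree

-- The recursion raises its own parameters: a maximum at the front, or between the two runs,
-- lengthens a run. Induction on `a`, `b`, `c` therefore cannot prove a closed form. But every child
-- carries a factor z, so agreement of all trees up to order n gives agreement up to order n + 1.
-- This induction on the order takes the place of a uniqueness statement for the infinite system.
--
-- Descendants are counted over all insertions. Since an occurrence of a forbidden pattern persists,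
-- insertion at a dead position contributes 0, and only live positions remain in the sums.
--
-- The states move from `treeA` to `treeE` to `treeF` and never back. An insertion behind the first
-- entry of the second run has the ascent between the two runs to its left, which kills every
-- position before the last entry of the first run. An insertion behind the second run kills the
-- position between the runs as well.
--
-- The denominator of the theorem is 2z `q`, and the polynomial in front of its square root is
-- `λ-poly` + `μ-poly`.

sum< : ℕ → (ℕ → ℕ) → ℕ
sum< zero    f = 0
sum< (suc n) f = f n ℕ.+ sum< n f

-- The ways to cut the first run: i + j = l + e + 1 with i < l. The new maximum heads the part cut
-- off, which is why j starts at e + 2.
antidiagonal : (ℕ → ℕ → ℕ) → ℕ → ℕ → ℕ
antidiagonal f zero    e = 0
antidiagonal f (suc l) e = antidiagonal f l (suc e) ℕ.+ f l (suc (suc e))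

-- Numbers of k-step descendants. In treeF all c live positions are preceded by a 12. In treeE the
-- position between the two runs is live, and so are b positions in the second run and c after it.
-- In treeA the word avoids 123 and its pieces have lengths a + 1, b and c.
treeF : ℕ → ℕ → ℕ
treeF zero    c = 1
treeF (suc k) c = sum< c (λ j → treeF k (suc j))

treeE : ℕ → ℕ → ℕ → ℕ
treeE zero    b c = 1
treeE (suc k) b c =
  treeE k (suc b) c ℕ.+ (sum< b (λ j → treeE k 0 (suc (j ℕ.+ c))) ℕ.+ sum< c (λ j → treeF k (suc j)))

treeA : ℕ → ℕ → ℕ → ℕ → ℕ
treeA zero    a b c = 1
treeA (suc k) a b c =
  (treeA k (suc a) b c ℕ.+ antidiagonal (λ i j → treeA k i j (b ℕ.+ c)) a 0)
  ℕ.+ (treeA k a (suc b) c ℕ.+ (sum< b (λ j → treeE k 0 (suc (j ℕ.+ c))) ℕ.+ sum< c (λ j → treeF k (suc j))))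

-- Polynomial identities and closed forms

ℤ-rawRing : RawRing 0ℓ 0ℓ
ℤ-rawRing = CommutativeRing.rawRing ℤₚ.+-*-commutativeRing

module Identities {r₁ r₂} (R : AlmostCommutativeRing r₁ r₂)
                  (morphism : ℤ-rawRing -Raw-AlmostCommutative⟶ R) where
  open AlmostCommutativeRing R
  open _-Raw-AlmostCommutative⟶_ morphism using (⟦_⟧)

  coefficient-≟ : (m n : ℤ) → Maybe (⟦ m ⟧ ≈ ⟦ n ⟧)
  coefficient-≟ m n with m ℤₚ.≟ n
  ... | yes m≡n = just (reflexive (≡.cong ⟦_⟧ m≡n))
  ... | no  _   = nothing

  open Algebra.Solver.Ring ℤ-rawRing R morphism coefficient-≟
    using (Polynomial; con; solve; _:=_; _:+_; _:*_; _:-_; :-_) public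

  infixl 6 _-_
  _-_ : Carrier → Carrier → Carrier
  x - y = x + (- y)

  private
    ⁰ ¹ ² : Carrier
    ⁰ = ⟦ + 0 ⟧
    ¹ = ⟦ + 1 ⟧
    ² = ⟦ + 2 ⟧

  ≈⇒-≈0 : ∀ {p q} → p ≈ q → p - q ≈ ⁰
  ≈⇒-≈0 {p} {q} p≈q = trans (+-congʳ p≈q) (solve 1 (λ q → q :- q := con (+ 0)) refl q)

  -- Identities below hold modulo the equations for u and M: the solver is given the explicit
  -- cofactor r of each equation p ≈ q.
  absorb : ∀ {x y} r {p q} → x ≈ y + r * (p - q) → p ≈ q → x ≈ y
  absorb {x} {y} r h p≈q = trans h (trans (+-congˡ (*-congˡ (≈⇒-≈0 p≈q)))
    (solve 2 (λ y r → y :+ r :* con (+ 0) := y) refl y r))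

  horner : List ℤ → Carrier → Carrier
  horner []       z = ⁰
  horner (k ∷ ks) z = ⟦ k ⟧ + z * horner ks z

  hornerᵖ : ∀ {n} → List ℤ → Polynomial n → Polynomial n
  hornerᵖ []       z = con (+ 0)
  hornerᵖ (k ∷ ks) z = con k :+ z :* hornerᵖ ks z

  -- Since u - 1 = z u, the sum of the terms z u^j telescopes; this is the inductive step.
  geometric : ∀ z u X → (¹ - z) * u ≈ ¹ → z * (u * X) + (X - ¹) ≈ u * X - ¹
  geometric z u X e = absorb (- X)
    (solve 3 (λ z u X → z :* (u :* X) :+ (X :- con (+ 1))
      := u :* X :- con (+ 1) :+ :- X :* ((con (+ 1) :- z) :* u :- con (+ 1))) refl z u X) e

  -- The ansatz for `treeA` leaves two conditions: `h-relation` from the terms with u^b,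
  -- `q-relation` from those without. As q : h is (1 - 3z + z²) : (1 - 2z), the second determines μ
  -- and then the first determines λ, both up to the factor ρ = (2 - z)²(1 - 2z), which clears their
  -- denominators.
  λ-poly μ-poly ρ-poly : Carrier → Carrier
  λ-poly z = (¹ - ² * z) * (¹ - ² * z) * (² - z) + z * (¹ - z) * (¹ - z) * (¹ + z) + z * z * (¹ - z) * (² - z)
  μ-poly z = - (z * (¹ - z) * (² - z))
  ρ-poly z = (² - z) * (² - z) * (¹ - ² * z)

  λᵖ μᵖ ρᵖ : ∀ {n} → Polynomial n → Polynomial n
  λᵖ z = (con (+ 1) :- con (+ 2) :* z) :* (con (+ 1) :- con (+ 2) :* z) :* (con (+ 2) :- z)
         :+ z :* (con (+ 1) :- z) :* (con (+ 1) :- z) :* (con (+ 1) :+ z) :+ z :* z :* (con (+ 1) :- z) :* (con (+ 2) :- z)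
  μᵖ z = :- (z :* (con (+ 1) :- z) :* (con (+ 2) :- z))
  ρᵖ z = (con (+ 2) :- z) :* (con (+ 2) :- z) :* (con (+ 1) :- con (+ 2) :* z)

  h-relation : ∀ z → (¹ - ² * z) * ρ-poly z
    ≈ λ-poly z * (² - z) + μ-poly z + z * (μ-poly z * (² - z)) - z * z * μ-poly z
  h-relation = solve 1 (λ z → (con (+ 1) :- con (+ 2) :* z) :* ρᵖ z
    := λᵖ z :* (con (+ 2) :- z) :+ μᵖ z :+ z :* (μᵖ z :* (con (+ 2) :- z)) :- z :* z :* μᵖ z) refl

  q-relation : ∀ z → ρ-poly z * horner (+ 1 ∷ -[1+ 2 ] ∷ + 1 ∷ []) z
    ≈ (¹ - ² * z) * ρ-poly z + (¹ - ² * z) * (μ-poly z * (² - z))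
  q-relation = solve 1 (λ z → ρᵖ z :* hornerᵖ (+ 1 ∷ -[1+ 2 ] ∷ + 1 ∷ []) z
    := (con (+ 1) :- con (+ 2) :* z) :* ρᵖ z :+ (con (+ 1) :- con (+ 2) :* z) :* (μᵖ z :* (con (+ 2) :- z))) refl

  e-step : ∀ z u X V r → (¹ - z) * u ≈ ¹ →
    let q = r * horner (+ 1 ∷ -[1+ 2 ] ∷ + 1 ∷ []) z in
    q + (z * (r * (((¹ - z) * (u * X) - z) * V)) + (¹ - ² * z) * r * ((X - ¹) * V) + q * (V - ¹))
      ≈ r * (((¹ - z) * X - z) * V)
  e-step z u X V r e = absorb (r * z * X * V)
    (solve 5 (λ z u X V r →
      let ¹ = con (+ 1)
          ² = con (+ 2)
          q = r :* hornerᵖ (+ 1 ∷ -[1+ 2 ] ∷ + 1 ∷ []) z in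
      q :+ (z :* (r :* (((¹ :- z) :* (u :* X) :- z) :* V)) :+ (¹ :- ² :* z) :* r :* ((X :- ¹) :* V) :+ q :* (V :- ¹))
      := r :* (((¹ :- z) :* X :- z) :* V) :+ r :* z :* X :* V :* ((¹ :- z) :* u :- ¹)) refl z u X V r) e

  d-step : ∀ z u M V W U X I l m → (¹ - z) * u ≈ ¹ → M ≈ u + z * (M * M) →
    let b = m * (² - z) in
    (((l + m) * (u * W - u * U) + l * (u * U - u)
        + m * (z * (u * U) - z * (¹ + I) * u + U - ¹)) * (u * X) + z * I * b) * V
      + z * ((((l + m) * (¹ - z) * M * (M * W) + l + z * m * (¹ + I)) * (u * (u * X)) + b) * V)
    ≈ (((l + m) * (u * (M * W) - u * (u * U)) + l * (u * (u * U) - u)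
        + m * (z * (u * (u * U)) - z * (¹ + (¹ + I)) * u + u * U - ¹)) * X + z * (¹ + I) * b) * V
  d-step z u M V W U X I l m e₁ e₂ = absorb _ (absorb _
    (solve 10 (λ z u M V W U X I l m →
      let ¹ = con (+ 1)
          b = m :* (con (+ 2) :- z) in
      (((l :+ m) :* (u :* W :- u :* U) :+ l :* (u :* U :- u)
          :+ m :* (z :* (u :* U) :- z :* (¹ :+ I) :* u :+ U :- ¹)) :* (u :* X) :+ z :* I :* b) :* V
        :+ z :* ((((l :+ m) :* (¹ :- z) :* M :* (M :* W) :+ l :+ z :* m :* (¹ :+ I)) :* (u :* (u :* X)) :+ b) :* V)
      := ((((l :+ m) :* (u :* (M :* W) :- u :* (u :* U)) :+ l :* (u :* (u :* U) :- u)
          :+ m :* (z :* (u :* (u :* U)) :- z :* (¹ :+ (¹ :+ I)) :* u :+ u :* U :- ¹)) :* X :+ z :* (¹ :+ I) :* b) :* V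
         :+ V :* X :* ((l :+ m) :* W :* u :* z :* M :* M :- l :* u :- m :* (z :* (¹ :+ I) :* u :+ ¹)) :* ((¹ :- z) :* u :- ¹))
         :+ :- (V :* X :* (l :+ m) :* W :* u) :* (M :- (u :+ z :* (M :* M))))
    refl z u M V W U X I l m) e₂) e₁

  -- Here W = M^a and U = u^a. The antidiagonal sum produces terms in U, which the closed form does
  -- not have; their cancellation forces the coefficient λ + μ of the power of M.
  a-step : ∀ z u M X V W U a l m h q → (¹ - z) * u ≈ ¹ → M ≈ u + z * (M * M) →
    let b = m * (² - z)
        y = λ P A X → (((l + m) * (¹ - z) * M * P + l + z * m * A) * X + b) * V
    in h ≈ l * (² - z) + m + z * b - z * z * m → q ≈ h + (¹ - ² * z) * b →
       q + (z * y (M * (M * W)) (¹ + (¹ + a)) X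
            + (((l + m) * (u * W - u * U) + l * (u * U - u)
                 + m * (z * (u * U) - z * (¹ + a) * u + U - ¹)) * ¹ + z * a * b) * (X * V)
            + z * y (M * W) (¹ + a) (u * X)
            + h * ((X - ¹) * V) + q * (V - ¹))
       ≈ y (M * W) (¹ + a) X
  a-step z u M X V W U a l m h q e₁ e₂ e₃ e₄ = absorb _ (absorb _ (absorb _ (absorb _
    (solve 12 (λ z u M X V W U a l m h q →
    let ¹ = con (+ 1)
        ² = con (+ 2)
        b = m :* (² :- z)
        y = λ P A X → (((l :+ m) :* (¹ :- z) :* M :* P :+ l :+ z :* m :* A) :* X :+ b) :* V
    in q :+ (z :* y (M :* (M :* W)) (¹ :+ (¹ :+ a)) X
            :+ (((l :+ m) :* (u :* W :- u :* U) :+ l :* (u :* U :- u)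
                 :+ m :* (z :* (u :* U) :- z :* (¹ :+ a) :* u :+ U :- ¹)) :* ¹ :+ z :* a :* b) :* (X :* V)
            :+ z :* y (M :* W) (¹ :+ a) (u :* X)
            :+ h :* ((X :- ¹) :* V) :+ q :* (V :- ¹))
       := (((y (M :* W) (¹ :+ a) X
            :+ :- (V :* X :* ((l :+ m) :* W :* u :+ m :* U :+ z :* m :* (¹ :+ a) :+ l)) :* ((¹ :- z) :* u :- ¹))
            :+ :- (V :* X :* (l :+ m) :* W :* (¹ :- z) :* (M :+ u)) :* (M :- (u :+ z :* (M :* M))))
            :+ X :* V :* (h :- (l :* (² :- z) :+ m :+ z :* b :- z :* z :* m)))
            :+ V :* (q :- (h :+ (¹ :- ² :* z) :* b)))
    refl z u M X V W U a l m h q) e₄) e₃) e₂) e₁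

  -- Completing the square in z M² - M + u = 0: the discriminant 1 - 4zu times (1 - z)² is (1 - z)(1
  -- - 5z).
  √-square : ∀ z u M → (¹ - z) * u ≈ ¹ → M ≈ u + z * (M * M) →
    let S = ¹ - z - ² * z * (¹ - z) * M in S * S ≈ horner (+ 1 ∷ -[1+ 5 ] ∷ + 5 ∷ []) z
  √-square z u M e₁ e₂ = absorb _ (absorb _
    (solve 3 (λ z u M →
      let ¹ = con (+ 1)
          S = ¹ :- z :- con (+ 2) :* z :* (¹ :- z) :* M in
      S :* S := (hornerᵖ (+ 1 ∷ -[1+ 5 ] ∷ + 5 ∷ []) z
        :+ :- (con (+ 4) :* z :* (¹ :- z)) :* ((¹ :- z) :* u :- ¹))
        :+ :- (con (+ 4) :* z :* (¹ :- z) :* (¹ :- z)) :* (M :- (u :+ z :* (M :* M)))) refl z u M) e₂) e₁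

  -- The left factor is 2z q, so 2z² times the closed form of q A enters. By z M² = M - u, the
  -- square becomes 2z²(1 - z)M² = 1 - 3z - S, which leaves -(λ + μ) as the coefficient of S.
  closed-form : ∀ z u M A P S → (¹ - z) * u ≈ ¹ → M ≈ u + z * (M * M) →
    ρ-poly z * horner (+ 1 ∷ -[1+ 2 ] ∷ + 1 ∷ []) z * A
      ≈ (((λ-poly z + μ-poly z) * (¹ - z) * M * (M * ¹) + λ-poly z + z * μ-poly z * (¹ + ⁰)) * ¹
          + μ-poly z * (² - z)) * ¹ →
    P ≈ ¹ + z * A →
    S ≈ ¹ - z - ² * z * (¹ - z) * M →
    horner (+ 0 ∷ + 2 ∷ []) z * horner (+ 2 ∷ -[1+ 0 ] ∷ []) z * horner (+ 2 ∷ -[1+ 0 ] ∷ []) z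
      * horner (+ 1 ∷ -[1+ 1 ] ∷ []) z * horner (+ 1 ∷ -[1+ 2 ] ∷ + 1 ∷ []) z * P
    ≈ horner (+ 2 ∷ -[1+ 7 ] ∷ + 2 ∷ + 17 ∷ -[1+ 14 ] ∷ + 4 ∷ []) z
      - horner (+ 2 ∷ -[1+ 9 ] ∷ + 16 ∷ -[1+ 8 ] ∷ + 2 ∷ []) z * S
  closed-form z u M A P S e₁ e₂ e₃ e₄ e₅ = absorb _ (absorb _ (absorb _ (absorb _ (absorb _
    (solve 6 (λ z u M A P S →
      let ¹ = con (+ 1)
          ² = con (+ 2)
          D = hornerᵖ (+ 1 ∷ -[1+ 2 ] ∷ + 1 ∷ []) z
          Z = hornerᵖ (+ 0 ∷ + 2 ∷ []) z :* hornerᵖ (+ 2 ∷ -[1+ 0 ] ∷ []) z :* hornerᵖ (+ 2 ∷ -[1+ 0 ] ∷ []) z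
                :* hornerᵖ (+ 1 ∷ -[1+ 1 ] ∷ []) z :* D
          K = hornerᵖ (+ 2 ∷ -[1+ 9 ] ∷ + 16 ∷ -[1+ 8 ] ∷ + 2 ∷ []) z
          Y = (((λᵖ z :+ μᵖ z) :* (¹ :- z) :* M :* (M :* ¹) :+ λᵖ z :+ z :* μᵖ z :* (¹ :+ con (+ 0))) :* ¹
                 :+ μᵖ z :* (² :- z)) :* ¹ in
      Z :* P := ((((hornerᵖ (+ 2 ∷ -[1+ 7 ] ∷ + 2 ∷ + 17 ∷ -[1+ 14 ] ∷ + 4 ∷ []) z :- K :* S
        :+ :- (² :* z :* K) :* ((¹ :- z) :* u :- ¹))
        :+ :- (² :* z :* K :* (¹ :- z)) :* (M :- (u :+ z :* (M :* M))))
        :+ ² :* z :* z :* (ρᵖ z :* D :* A :- Y))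
        :+ Z :* (P :- (¹ :+ z :* A)))
        :+ K :* (S :- (¹ :- z :- ² :* z :* (¹ :- z) :* M)))
      refl z u M A P S) e₅) e₄) e₃) e₂) e₁

  -- Generating functions of the trees up to a given order

  module GeneratingFunctions
      (Agree : ℕ → Carrier → Carrier → Set) (z u M : Carrier) (embed : (ℕ → ℕ) → Carrier)
      (≈[]-zero : ∀ {x y} → Agree 0 x y)
      (≈⇒≈[] : ∀ {x y n} → x ≈ y → Agree n x y)
      (≈[]-trans : ∀ {x y w n} → Agree n x y → Agree n y w → Agree n x w)
      (≈[]-+ : ∀ {x y v w n} → Agree n x y → Agree n v w → Agree n (x + v) (y + w))
      (≈[]-shift : ∀ {x y n} → Agree n x y → Agree (suc n) (z * x) (z * y))
      (e₁ : (⟦ + 1 ⟧ + (- z)) * u ≈ ⟦ + 1 ⟧) (e₂ : M ≈ u + z * (M * M))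
      (embed-0 : embed (λ _ → 0) ≈ ⟦ + 0 ⟧)
      (embed-+ : ∀ f g → embed (λ k → f k ℕ.+ g k) ≈ embed f + embed g)
      (embed-step : ∀ f g → f 0 ≡ 1 → (∀ k → f (suc k) ≡ g k) → embed f ≈ ⟦ + 1 ⟧ + z * embed g)
      where
    infix 4 _≈[_]_
    _≈[_]_ : Carrier → ℕ → Carrier → Set
    x ≈[ n ] y = Agree n x y
    infixr 8 _^_
    _^_ : Carrier → ℕ → Carrier
    f ^ zero  = ⟦ + 1 ⟧
    f ^ suc n = f * f ^ n

    -- The closed forms are q times the generating functions of the trees. Every tree depends on c
    -- only through a factor u ^ c. For treeE and treeA an affine dependence on u ^ b is consistent;
    -- in treeA its slope obeys a linear recurrence in a, solved by M ^ a plus an affine function of a.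
    λ′ μ′ ρ q h β : Carrier
    λ′ = λ-poly z
    μ′ = μ-poly z
    ρ = ρ-poly z
    q = ρ * horner (+ 1 ∷ -[1+ 2 ] ∷ + 1 ∷ []) z
    h = (⟦ + 1 ⟧ - ⟦ + 2 ⟧ * z) * ρ
    β = μ′ * (⟦ + 2 ⟧ - z)

    ι : ℕ → Carrier
    ι zero    = ⟦ + 0 ⟧
    ι (suc n) = ⟦ + 1 ⟧ + ι n

    ^-+ : ∀ f m n → f ^ (m ℕ.+ n) ≈ f ^ m * f ^ n
    ^-+ f zero    n = solve 1 (λ x → x := con (+ 1) :* x) refl (f ^ n)
    ^-+ f (suc m) n = trans (*-congˡ (^-+ f m n)) (sym (*-assoc f (f ^ m) (f ^ n)))

    closedF : ℕ → Carrier
    closedF c = q * u ^ c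

    closedE : ℕ → ℕ → Carrier
    closedE b c = ρ * (((⟦ + 1 ⟧ - z) * u ^ b - z) * u ^ c)

    closedA : ℕ → ℕ → ℕ → Carrier
    closedA a b c = (((λ′ + μ′) * (⟦ + 1 ⟧ - z) * M * M ^ suc a + λ′ + z * μ′ * ι (suc a)) * u ^ b + β) * u ^ c

    -- z times the sum of `closedA` along an antidiagonal: the power of M and λ give geometric sums,
    -- μ an arithmetic-geometric one, and β gives l equal terms.
    closedD : ℕ → ℕ → ℕ → Carrier
    closedD l e c = (((λ′ + μ′) * (u * M ^ l - u * u ^ l) + λ′ * (u * u ^ l - u)
      + μ′ * (z * (u * u ^ l) - z * ι (suc l) * u + u ^ l - ⟦ + 1 ⟧)) * u ^ e + z * ι l * β) * u ^ c

    zq : (ℕ → ℕ) → Carrier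
    zq f = z * (q * embed f)

    zq-+ : ∀ f g → zq (λ k → f k ℕ.+ g k) ≈ zq f + zq g
    zq-+ f g = trans (*-congˡ (*-congˡ (embed-+ f g)))
      (solve 4 (λ z q x y → z :* (q :* (x :+ y)) := z :* (q :* x) :+ z :* (q :* y)) refl z q (embed f) (embed g))

    q-embed-step : ∀ f g → f 0 ≡ 1 → (∀ k → f (suc k) ≡ g k) → q * embed f ≈ q + zq g
    q-embed-step f g f₀ fₛ = trans (*-congˡ (embed-step f g f₀ fₛ))
      (solve 3 (λ z q x → q :* (con (+ 1) :+ z :* x) := q :+ z :* (q :* x)) refl z q (embed g))

    zq-0 : zq (λ _ → 0) ≈ ⟦ + 0 ⟧
    zq-0 = trans (*-congˡ (*-congˡ embed-0)) (solve 2 (λ z q → z :* (q :* con (+ 0)) := con (+ 0)) refl z q)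

    module _ {n} (ihF : ∀ c → q * embed (λ k → treeF k c) ≈[ n ] closedF c) where

      zq-sumF : ∀ c → zq (λ k → sum< c (λ j → treeF k (suc j))) ≈[ suc n ] q * (u ^ c - ⟦ + 1 ⟧)
      zq-sumF zero    = ≈⇒≈[] (trans zq-0 (solve 1 (λ q → con (+ 0) := q :* (con (+ 1) :- con (+ 1))) refl q))
      zq-sumF (suc k) = ≈[]-trans (≈⇒≈[] (zq-+ _ _)) (≈[]-trans (≈[]-+ (≈[]-shift (ihF (suc k))) (zq-sumF k))
        (≈⇒≈[] (trans
          (solve 4 (λ z q u x → z :* (q :* (u :* x)) :+ q :* (x :- con (+ 1)) := q :* (z :* (u :* x) :+ (x :- con (+ 1))))
            refl z q u (u ^ k))
          (*-congˡ (geometric z u (u ^ k) e₁)))))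

    module _ {n} (ihE : ∀ b c → q * embed (λ k → treeE k b c) ≈[ n ] closedE b c) where

      zq-sumE : ∀ b c → zq (λ k → sum< b (λ j → treeE k 0 (suc (j ℕ.+ c)))) ≈[ suc n ] h * ((u ^ b - ⟦ + 1 ⟧) * u ^ c)
      zq-sumE zero    c′ = ≈⇒≈[] (trans zq-0 (solve 2 (λ h v → con (+ 0) := h :* ((con (+ 1) :- con (+ 1)) :* v)) refl h (u ^ c′)))
      zq-sumE (suc b) c′ = ≈[]-trans (≈⇒≈[] (zq-+ _ _)) (≈[]-trans (≈[]-+ (≈[]-shift (ihE 0 (suc (b ℕ.+ c′)))) (zq-sumE b c′))
        (≈⇒≈[] (trans (+-congʳ
            (*-congˡ (*-congˡ (*-congˡ (*-congˡ (^-+ u b c′))))))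
          (trans
            (solve 5 (λ z r u x v →
                z :* (r :* (((con (+ 1) :- z) :* con (+ 1) :- z) :* (u :* (x :* v)))) :+ (con (+ 1) :- con (+ 2) :* z) :* r :* ((x :- con (+ 1)) :* v)
                := (con (+ 1) :- con (+ 2) :* z) :* r :* ((z :* (u :* x) :+ (x :- con (+ 1))) :* v))
              refl z ρ u (u ^ b) (u ^ c′))
            (*-congˡ (*-congʳ (geometric z u (u ^ b) e₁)))))))

    module _ {n} (ihA : ∀ a b c → q * embed (λ k → treeA k a b c) ≈[ n ] closedA a b c) where

      zq-antidiagonal : ∀ l e c → zq (λ k → antidiagonal (λ i j → treeA k i j c) l e) ≈[ suc n ] closedD l e c
      zq-antidiagonal zero e c′ = ≈⇒≈[] (trans zq-0
        (solve 7 (λ z u l m x b v → con (+ 0) :=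
           (((l :+ m) :* (u :* con (+ 1) :- u :* con (+ 1)) :+ l :* (u :* con (+ 1) :- u)
             :+ m :* (z :* (u :* con (+ 1)) :- z :* (con (+ 1) :+ con (+ 0)) :* u :+ con (+ 1) :- con (+ 1))) :* x :+ z :* con (+ 0) :* b) :* v)
          refl z u λ′ μ′ (u ^ e) β (u ^ c′)))
      zq-antidiagonal (suc l) e c′ = ≈[]-trans (≈⇒≈[] (zq-+ _ _)) (≈[]-trans
        (≈[]-+ (zq-antidiagonal l (suc e) c′) (≈[]-shift (ihA l (suc (suc e)) c′)))
        (≈⇒≈[] (d-step z u M (u ^ c′) (M ^ l) (u ^ l) (u ^ e) (ι l) λ′ μ′ e₁ e₂)))

    treeF-closed : ∀ n c → q * embed (λ k → treeF k c) ≈[ n ] closedF c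
    treeF-closed zero    c = ≈[]-zero
    treeF-closed (suc n) c′ = ≈[]-trans
      (≈⇒≈[] (q-embed-step (λ k → treeF k c′) (λ k → sum< c′ (λ j → treeF k (suc j))) ≡.refl (λ _ → ≡.refl)))
      (≈[]-trans (≈[]-+ (≈⇒≈[] refl) (zq-sumF (treeF-closed n) c′))
        (≈⇒≈[] (solve 2 (λ q x → q :+ q :* (x :- con (+ 1)) := q :* x) refl q (u ^ c′))))

    treeE-closed : ∀ n b c → q * embed (λ k → treeE k b c) ≈[ n ] closedE b c
    treeE-closed zero    b c = ≈[]-zero
    treeE-closed (suc n) b c′ = ≈[]-trans
      (≈⇒≈[] (trans
        (q-embed-step (λ k → treeE k b c′)
          (λ k → treeE k (suc b) c′ ℕ.+ (sum< b (λ j → treeE k 0 (suc (j ℕ.+ c′))) ℕ.+ sum< c′ (λ j → treeF k (suc j))))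
          ≡.refl (λ _ → ≡.refl))
        (+-congˡ (trans (zq-+ _ _) (+-congˡ (zq-+ _ _))))))
      (≈[]-trans
        (≈[]-+ (≈⇒≈[] refl) (≈[]-+ (≈[]-shift (treeE-closed n (suc b) c′))
          (≈[]-+ (zq-sumE (treeE-closed n) b c′) (zq-sumF (treeF-closed n) c′))))
        (≈⇒≈[] (trans (solve 4 (λ x y s t → x :+ (y :+ (s :+ t)) := x :+ (y :+ s :+ t)) refl q _ _ _)
          (e-step z u (u ^ b) (u ^ c′) ρ e₁))))

    treeA-closed : ∀ n a b c → q * embed (λ k → treeA k a b c) ≈[ n ] closedA a b c
    treeA-closed zero    a b c = ≈[]-zero
    treeA-closed (suc n) a b c′ = ≈[]-trans
      (≈⇒≈[] (trans
        (q-embed-step (λ k → treeA k a b c′)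
          (λ k → (treeA k (suc a) b c′ ℕ.+ antidiagonal (λ i j → treeA k i j (b ℕ.+ c′)) a 0)
            ℕ.+ (treeA k a (suc b) c′ ℕ.+ (sum< b (λ j → treeE k 0 (suc (j ℕ.+ c′))) ℕ.+ sum< c′ (λ j → treeF k (suc j)))))
          ≡.refl (λ _ → ≡.refl))
        (+-congˡ (trans (zq-+ _ _) (+-cong (zq-+ _ _)
          (trans (zq-+ _ _) (+-congˡ (zq-+ _ _))))))))
      (≈[]-trans
        (≈[]-+ (≈⇒≈[] refl) (≈[]-+
          (≈[]-+ (≈[]-shift (treeA-closed n (suc a) b c′))
            (≈[]-trans (zq-antidiagonal (treeA-closed n) a 0 (b ℕ.+ c′)) (≈⇒≈[] (*-congˡ (^-+ u b c′)))))
          (≈[]-+ (≈[]-shift (treeA-closed n a (suc b) c′))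
            (≈[]-+ (zq-sumE (treeE-closed n) b c′) (zq-sumF (treeF-closed n) c′)))))
        (≈⇒≈[] (trans (solve 6 (λ x y d w s t → x :+ ((y :+ d) :+ (w :+ (s :+ t))) := x :+ (y :+ d :+ w :+ s :+ t)) refl q _ _ _ _ _)
          (a-step z u M (u ^ b) (u ^ c′) (M ^ a) (u ^ a) (ι a) λ′ μ′ h q e₁ e₂ (h-relation z) (q-relation z)))))

open import Data.Nat using (_+_)
open import Relation.Binary.PropositionalEquality
  using (refl; sym; trans; cong; cong₂; subst; setoid; _≢_; ≢-sym; module ≡-Reasoning)

-- Formal power series

sumTo-cong : ∀ n {f g : ℕ → ℤ} → (∀ k → k ≤ n → f k ≡ g k) → sumTo n f ≡ sumTo n g
sumTo-cong zero    h = h 0 z≤n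
sumTo-cong (suc n) h =
  cong₂ _+ℤ_ (sumTo-cong n λ k k≤n → h k (ℕₚ.m≤n⇒m≤1+n k≤n)) (h (suc n) ℕₚ.≤-refl)

sumTo-head : ∀ n (f : ℕ → ℤ) → sumTo (suc n) f ≡ f 0 +ℤ sumTo n (f ∘ suc)
sumTo-head zero    f = refl
sumTo-head (suc n) f =
  trans (cong (_+ℤ f (suc (suc n))) (sumTo-head n f)) (ℤₚ.+-assoc (f 0) _ _)

tail : PS → PS
tail f = f ∘ suc

⊛-head : ∀ f g n → (f ⊛ g) (suc n) ≡ f 0 *ℤ g (suc n) +ℤ (tail f ⊛ g) n
⊛-head f g n = sumTo-head n _

⊛-last : ∀ f g n → (f ⊛ g) (suc n) ≡ (f ⊛ tail g) n +ℤ f (suc n) *ℤ g 0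
⊛-last f g n = cong₂ _+ℤ_
  (sumTo-cong n λ k k≤n → cong (λ i → f k *ℤ g i) (ℕₚ.+-∸-assoc 1 k≤n))
  (cong (λ i → f (suc n) *ℤ g i) (ℕₚ.n∸n≡0 n))

≋-refl : ∀ {f} → f ≋ f
≋-refl n = refl

≋-sym : ∀ {f g} → f ≋ g → g ≋ f
≋-sym h n = sym (h n)

≋-trans : ∀ {f g h} → f ≋ g → g ≋ h → f ≋ h
≋-trans p q n = trans (p n) (q n)

⊛-cong : ∀ {f f′ g g′} → f ≋ f′ → g ≋ g′ → f ⊛ g ≋ f′ ⊛ g′
⊛-cong p q n = sumTo-cong n λ k _ → cong₂ _*ℤ_ (p k) (q (n ∸ k))

-- Splitting off the first summand on one side matches splitting off the last on the other.
⊛-comm : ∀ f g → f ⊛ g ≋ g ⊛ f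
⊛-comm f g zero    = ℤₚ.*-comm (f 0) (g 0)
⊛-comm f g (suc n) = begin
  (f ⊛ g) (suc n)                        ≡⟨ ⊛-head f g n ⟩
  f 0 *ℤ g (suc n) +ℤ (tail f ⊛ g) n     ≡⟨ cong₂ _+ℤ_ (ℤₚ.*-comm (f 0) _) (⊛-comm (tail f) g n) ⟩
  g (suc n) *ℤ f 0 +ℤ (g ⊛ tail f) n     ≡⟨ ℤₚ.+-comm _ ((g ⊛ tail f) n) ⟩
  (g ⊛ tail f) n +ℤ g (suc n) *ℤ f 0     ≡⟨ ⊛-last g f n ⟨
  (g ⊛ f) (suc n)                        ∎
  where open ≡-Reasoning

⊛-distribʳ : ∀ f g h → (g ⊕ h) ⊛ f ≋ (g ⊛ f) ⊕ (h ⊛ f)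
⊛-distribʳ f g h zero    = ℤₚ.*-distribʳ-+ (f 0) (g 0) (h 0)
⊛-distribʳ f g h (suc n) = begin
  ((g ⊕ h) ⊛ f) (suc n)
    ≡⟨ ⊛-head (g ⊕ h) f n ⟩
  (g 0 +ℤ h 0) *ℤ f (suc n) +ℤ ((tail g ⊕ tail h) ⊛ f) n
    ≡⟨ cong₂ _+ℤ_ (ℤₚ.*-distribʳ-+ (f (suc n)) (g 0) (h 0)) (⊛-distribʳ f (tail g) (tail h) n) ⟩
  (g 0 *ℤ f (suc n) +ℤ h 0 *ℤ f (suc n)) +ℤ ((tail g ⊛ f) n +ℤ (tail h ⊛ f) n)
    ≡⟨ interchange (g 0 *ℤ f (suc n)) _ _ _ ⟩
  (g 0 *ℤ f (suc n) +ℤ (tail g ⊛ f) n) +ℤ (h 0 *ℤ f (suc n) +ℤ (tail h ⊛ f) n)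
    ≡⟨ cong₂ _+ℤ_ (⊛-head g f n) (⊛-head h f n) ⟨
  (g ⊛ f) (suc n) +ℤ (h ⊛ f) (suc n) ∎
  where
  open ≡-Reasoning
  interchange : ∀ a b c d → (a +ℤ b) +ℤ (c +ℤ d) ≡ (a +ℤ c) +ℤ (b +ℤ d)
  interchange = solve-∀

⊛-scaleˡ : ∀ c f g n → ((λ m → c *ℤ f m) ⊛ g) n ≡ c *ℤ (f ⊛ g) n
⊛-scaleˡ c f g zero    = ℤₚ.*-assoc c (f 0) (g 0)
⊛-scaleˡ c f g (suc n) = begin
  ((λ m → c *ℤ f m) ⊛ g) (suc n)
    ≡⟨ ⊛-head (λ m → c *ℤ f m) g n ⟩
  c *ℤ f 0 *ℤ g (suc n) +ℤ ((λ m → c *ℤ tail f m) ⊛ g) n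
    ≡⟨ cong₂ _+ℤ_ (ℤₚ.*-assoc c (f 0) _) (⊛-scaleˡ c (tail f) g n) ⟩
  c *ℤ (f 0 *ℤ g (suc n)) +ℤ c *ℤ (tail f ⊛ g) n
    ≡⟨ ℤₚ.*-distribˡ-+ c _ _ ⟨
  c *ℤ (f 0 *ℤ g (suc n) +ℤ (tail f ⊛ g) n)
    ≡⟨ cong (c *ℤ_) (⊛-head f g n) ⟨
  c *ℤ (f ⊛ g) (suc n) ∎
  where open ≡-Reasoning

⊛-assoc : ∀ f g h → (f ⊛ g) ⊛ h ≋ f ⊛ (g ⊛ h)
⊛-assoc f g h zero    = ℤₚ.*-assoc (f 0) (g 0) (h 0)
⊛-assoc f g h (suc n) = begin
  ((f ⊛ g) ⊛ h) (suc n)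
    ≡⟨ ⊛-head (f ⊛ g) h n ⟩
  f 0 *ℤ g 0 *ℤ h (suc n) +ℤ (tail (f ⊛ g) ⊛ h) n
    ≡⟨ cong (f 0 *ℤ g 0 *ℤ h (suc n) +ℤ_) (⊛-cong {g = h} (⊛-head f g) (λ _ → refl) n) ⟩
  f 0 *ℤ g 0 *ℤ h (suc n) +ℤ (((λ m → f 0 *ℤ tail g m) ⊕ (tail f ⊛ g)) ⊛ h) n
    ≡⟨ cong (f 0 *ℤ g 0 *ℤ h (suc n) +ℤ_) (⊛-distribʳ h (λ m → f 0 *ℤ tail g m) (tail f ⊛ g) n) ⟩
  f 0 *ℤ g 0 *ℤ h (suc n) +ℤ (((λ m → f 0 *ℤ tail g m) ⊛ h) n +ℤ ((tail f ⊛ g) ⊛ h) n)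
    ≡⟨ cong (f 0 *ℤ g 0 *ℤ h (suc n) +ℤ_)
         (cong₂ _+ℤ_ (⊛-scaleˡ (f 0) (tail g) h n) (⊛-assoc (tail f) g h n)) ⟩
  f 0 *ℤ g 0 *ℤ h (suc n) +ℤ (f 0 *ℤ (tail g ⊛ h) n +ℤ (tail f ⊛ (g ⊛ h)) n)
    ≡⟨ factor (f 0) (g 0) (h (suc n)) _ _ ⟩
  f 0 *ℤ (g 0 *ℤ h (suc n) +ℤ (tail g ⊛ h) n) +ℤ (tail f ⊛ (g ⊛ h)) n
    ≡⟨ cong (λ x → f 0 *ℤ x +ℤ (tail f ⊛ (g ⊛ h)) n) (⊛-head g h n) ⟨
  f 0 *ℤ (g ⊛ h) (suc n) +ℤ (tail f ⊛ (g ⊛ h)) n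
    ≡⟨ ⊛-head f (g ⊛ h) n ⟨
  (f ⊛ (g ⊛ h)) (suc n) ∎
  where
  open ≡-Reasoning
  factor : ∀ a b c d e → a *ℤ b *ℤ c +ℤ (a *ℤ d +ℤ e) ≡ a *ℤ (b *ℤ c +ℤ d) +ℤ e
  factor = solve-∀

const : ℤ → PS
const c zero    = c
const c (suc n) = + 0

const-0 : ∀ n → const (+ 0) n ≡ + 0
const-0 zero    = refl
const-0 (suc n) = refl

const-⊛ : ∀ c f n → (const c ⊛ f) n ≡ c *ℤ f n
const-⊛ c f zero    = refl
const-⊛ c f (suc n) = trans (⊛-head (const c) f n)
  (trans (cong (c *ℤ f (suc n) +ℤ_) (zero-⊛ n)) (ℤₚ.+-identityʳ _))
  where
  zero-⊛ : ∀ n → ((λ _ → + 0) ⊛ f) n ≡ + 0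
  zero-⊛ zero    = refl
  zero-⊛ (suc n) = trans (⊛-head (λ _ → + 0) f n) (trans (ℤₚ.+-identityˡ _) (zero-⊛ n))

-PS_ : PS → PS
(-PS f) n = -ℤ f n

PS-commutativeRing : CommutativeRing 0ℓ 0ℓ
PS-commutativeRing = record
  { Carrier = PS ; _≈_ = _≋_ ; _+_ = _⊕_ ; _*_ = _⊛_ ; -_ = -PS_
  ; 0# = const (+ 0) ; 1# = const (+ 1)
  ; isCommutativeRing = record
    { isRing = record
      { +-isAbelianGroup = record
        { isGroup = record
          { isMonoid = record
            { isSemigroup = record
              { isMagma = record
                { isEquivalence = record { refl = ≋-refl ; sym = ≋-sym ; trans = ≋-trans }
                ; ∙-cong = λ p q n → cong₂ _+ℤ_ (p n) (q n) }
              ; assoc = λ f g h n → ℤₚ.+-assoc (f n) (g n) (h n) }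
            ; identity = (λ f n → trans (cong (_+ℤ f n) (const-0 n)) (ℤₚ.+-identityˡ (f n)))
                       , (λ f n → trans (cong (f n +ℤ_) (const-0 n)) (ℤₚ.+-identityʳ (f n))) }
          ; inverse = (λ f n → trans (ℤₚ.+-inverseˡ (f n)) (sym (const-0 n)))
                    , (λ f n → trans (ℤₚ.+-inverseʳ (f n)) (sym (const-0 n)))
          ; ⁻¹-cong = λ p n → cong -ℤ_ (p n) }
        ; comm = λ f g n → ℤₚ.+-comm (f n) (g n) }
      ; *-cong = ⊛-cong
      ; *-assoc = ⊛-assoc
      ; *-identity = 1-⊛ , (λ f → ≋-trans (⊛-comm f (const (+ 1))) (1-⊛ f))
      ; distrib = (λ f g h → ≋-trans (⊛-comm f (g ⊕ h)) (≋-trans (⊛-distribʳ f g h)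
                     (λ n → cong₂ _+ℤ_ (⊛-comm g f n) (⊛-comm h f n))))
                , ⊛-distribʳ }
    ; *-comm = ⊛-comm } }
  where
  1-⊛ : ∀ f → const (+ 1) ⊛ f ≋ f
  1-⊛ f n = trans (const-⊛ (+ 1) f n) (ℤₚ.*-identityˡ (f n))

const-morphism : ℤ-rawRing -Raw-AlmostCommutative⟶ fromCommutativeRing PS-commutativeRing
const-morphism = record
  { ⟦_⟧ = const
  ; +-homo = λ { a b zero → refl ; a b (suc n) → refl }
  ; *-homo = λ { a b zero → refl ; a b (suc n) → sym (trans (const-⊛ a (const b) (suc n)) (ℤₚ.*-zeroʳ a)) }
  ; -‿homo = λ { a zero → refl ; a (suc n) → refl }
  ; 0-homo = ≋-refl
  ; 1-homo = ≋-refl }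

-- Positions of a new maximum

-- Each keeps a chain of comparisons that implies all others. The descent is weak because
-- `orderIsoᵇ` tests only `<ᵇ`, whose failure means ≥.
Contains4123 Contains1243 Contains123 Contains12 Contains12ʳ : List ℕ → Set
Contains4123 w = ∃₂ λ a b → ∃₂ λ c d → (a ∷ b ∷ c ∷ d ∷ []) ⊆ w × b < c × c < d × d ≤ a
Contains1243 w = ∃₂ λ a b → ∃₂ λ c d → (a ∷ b ∷ c ∷ d ∷ []) ⊆ w × a < b × b < d × d ≤ c
Contains123 w = ∃ λ a → ∃₂ λ b c → (a ∷ b ∷ c ∷ []) ⊆ w × a < b × b < c
Contains12 w = ∃₂ λ a b → (a ∷ b ∷ []) ⊆ w × a < b
Contains12ʳ w = ∃₂ λ a b → (b ∷ a ∷ []) ⊆ w × a < b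

Bad : List ℕ → Set
Bad w = Contains4123 w ⊎ Contains1243 w

<ᵇ-true : ∀ {m n} → m < n → (m <ᵇ n) ≡ true
<ᵇ-true m<n = Equivalence.to 𝔹ₚ.T-≡ (ℕₚ.<⇒<ᵇ m<n)

<ᵇ-false : ∀ {m n} → n ≤ m → (m <ᵇ n) ≡ false
<ᵇ-false {m} {n} n≤m with m <ᵇ n in eq
... | false = refl
... | true  = contradiction (ℕₚ.<ᵇ⇒< m n (Equivalence.from 𝔹ₚ.T-≡ eq)) (ℕₚ.≤⇒≯ n≤m)

<ᵇ-true⁻ : ∀ m n → true ≡ (m <ᵇ n) → m < n
<ᵇ-true⁻ m n eq = ℕₚ.<ᵇ⇒< m n (Equivalence.from 𝔹ₚ.T-≡ (sym eq))

<ᵇ-false⁻ : ∀ m n → false ≡ (m <ᵇ n) → n ≤ m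
<ᵇ-false⁻ m n eq = ℕₚ.≮⇒≥ λ m<n → contradiction (trans eq (<ᵇ-true m<n)) λ ()

∧-true⁻ : ∀ x {y} → x ∧ y ≡ true → x ≡ true × y ≡ true
∧-true⁻ true eq = refl , eq

does-≟-true⁻ : ∀ x y → does (x 𝔹ₚ.≟ y) ≡ true → x ≡ y
does-≟-true⁻ false false _ = refl
does-≟-true⁻ true  true  _ = refl

any-true⁻ : ∀ {A : Set} (f : A → Bool) xs → any f xs ≡ true → ∃ λ x → x ∈ xs × f x ≡ true
any-true⁻ f (x ∷ xs) eq with f x in fx
... | true  = x , here refl , fx
... | false with any-true⁻ f xs eq
... | y , y∈xs , fy = y , there y∈xs , fy

any-true⁺ : ∀ {A : Set} (f : A → Bool) {xs x} → x ∈ xs → f x ≡ true → any f xs ≡ true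
any-true⁺ f (here refl) fx rewrite fx = refl
any-true⁺ f {y ∷ _} (there x∈xs) fx with f y
... | true  = refl
... | false = any-true⁺ f x∈xs fx

subseqs-⊆ : ∀ w {s} → s ∈ subseqs w → s ⊆ w
subseqs-⊆ []      (here refl) = []
subseqs-⊆ (x ∷ w) s∈ with ∈-++⁻ (map (x ∷_) (subseqs w)) s∈
... | inj₂ s∈w = x ∷ʳ subseqs-⊆ w s∈w
... | inj₁ s∈x with ∈-map⁻ (x ∷_) s∈x
... | _ , t∈w , refl = refl ∷ subseqs-⊆ w t∈w

⊆-subseqs : ∀ {s w} → s ⊆ w → s ∈ subseqs w
⊆-subseqs []         = here refl
⊆-subseqs {w = x ∷ w} (x ∷ʳ s⊆w)   = ∈-++⁺ʳ (map (x ∷_) (subseqs w)) (⊆-subseqs s⊆w)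
⊆-subseqs {w = x ∷ w} (refl ∷ s⊆w) = ∈-++⁺ˡ (∈-map⁺ (x ∷_) (⊆-subseqs s⊆w))

conjuncts : ∀ p q r s t v → (p ∧ q ∧ r ∧ true) ∧ (s ∧ t ∧ true) ∧ (v ∧ true) ∧ true ≡ true →
  (p ≡ true × q ≡ true × r ≡ true) × (s ≡ true × t ≡ true) × v ≡ true
conjuncts p q r s t v eq =
  let eq₁ , eq₂ = ∧-true⁻ (p ∧ q ∧ r ∧ true) eq
      eq₃ , eq₄ = ∧-true⁻ (s ∧ t ∧ true) eq₂
      p≡ , eq₅ = ∧-true⁻ p eq₁
      q≡ , eq₆ = ∧-true⁻ q eq₅
      s≡ , eq₇ = ∧-true⁻ s eq₃
  in (p≡ , q≡ , proj₁ (∧-true⁻ r eq₆)) , (s≡ , proj₁ (∧-true⁻ t eq₇))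
     , proj₁ (∧-true⁻ v (proj₁ (∧-true⁻ (v ∧ true) eq₄)))

orderIso-4123⁻ : ∀ s → orderIsoᵇ p4123 s ≡ true → Contains4123 s
orderIso-4123⁻ (a ∷ b ∷ c ∷ d ∷ []) eq
  with (_ , _ , ad) , (bc , _) , cd ← conjuncts
    (does (false 𝔹ₚ.≟ (a <ᵇ b))) (does (false 𝔹ₚ.≟ (a <ᵇ c))) (does (false 𝔹ₚ.≟ (a <ᵇ d)))
    (does (true 𝔹ₚ.≟ (b <ᵇ c))) (does (true 𝔹ₚ.≟ (b <ᵇ d))) (does (true 𝔹ₚ.≟ (c <ᵇ d))) eq
  = a , b , c , d , ⊆-refl
    , <ᵇ-true⁻ b c (does-≟-true⁻ _ _ bc) , <ᵇ-true⁻ c d (does-≟-true⁻ _ _ cd) , <ᵇ-false⁻ a d (does-≟-true⁻ _ _ ad)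

orderIso-4123⁺ : ∀ {a b c d} → b < c → c < d → d ≤ a → orderIsoᵇ p4123 (a ∷ b ∷ c ∷ d ∷ []) ≡ true
orderIso-4123⁺ {a} {b} {c} {d} b<c c<d d≤a
  rewrite <ᵇ-false d≤a | <ᵇ-false (ℕₚ.≤-trans (ℕₚ.<⇒≤ c<d) d≤a)
        | <ᵇ-false (ℕₚ.≤-trans (ℕₚ.<⇒≤ (ℕₚ.<-trans b<c c<d)) d≤a)
        | <ᵇ-true b<c | <ᵇ-true c<d | <ᵇ-true (ℕₚ.<-trans b<c c<d) = refl

orderIso-1243⁻ : ∀ s → orderIsoᵇ p1243 s ≡ true → Contains1243 s
orderIso-1243⁻ (a ∷ b ∷ c ∷ d ∷ []) eq
  with (ab , _) , (_ , bd) , cd ← conjuncts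
    (does (true 𝔹ₚ.≟ (a <ᵇ b))) (does (true 𝔹ₚ.≟ (a <ᵇ c))) (does (true 𝔹ₚ.≟ (a <ᵇ d)))
    (does (true 𝔹ₚ.≟ (b <ᵇ c))) (does (true 𝔹ₚ.≟ (b <ᵇ d))) (does (false 𝔹ₚ.≟ (c <ᵇ d))) eq
  = a , b , c , d , ⊆-refl
    , <ᵇ-true⁻ a b (does-≟-true⁻ _ _ ab) , <ᵇ-true⁻ b d (does-≟-true⁻ _ _ bd) , <ᵇ-false⁻ c d (does-≟-true⁻ _ _ cd)

orderIso-1243⁺ : ∀ {a b c d} → a < b → b < d → d ≤ c → orderIsoᵇ p1243 (a ∷ b ∷ c ∷ d ∷ []) ≡ true
orderIso-1243⁺ a<b b<d d≤c
  rewrite <ᵇ-true a<b | <ᵇ-true b<d | <ᵇ-false d≤c | <ᵇ-true (ℕₚ.<-≤-trans b<d d≤c)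
        | <ᵇ-true (ℕₚ.<-trans a<b b<d) | <ᵇ-true (ℕₚ.<-trans a<b (ℕₚ.<-≤-trans b<d d≤c)) = refl

containsᵇ-4123⁻ : ∀ w → containsᵇ w p4123 ≡ true → Contains4123 w
containsᵇ-4123⁻ w eq with any-true⁻ (orderIsoᵇ p4123) (subseqs w) eq
... | s , s∈ , iso with orderIso-4123⁻ s iso
... | a , b , c , d , t , rest = a , b , c , d , ⊆-trans t (subseqs-⊆ w s∈) , rest

containsᵇ-4123⁺ : ∀ {w} → Contains4123 w → containsᵇ w p4123 ≡ true
containsᵇ-4123⁺ (a , b , c , d , s , b<c , c<d , d≤a) =
  any-true⁺ (orderIsoᵇ p4123) (⊆-subseqs s) (orderIso-4123⁺ {a} {b} {c} {d} b<c c<d d≤a)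

containsᵇ-1243⁻ : ∀ w → containsᵇ w p1243 ≡ true → Contains1243 w
containsᵇ-1243⁻ w eq with any-true⁻ (orderIsoᵇ p1243) (subseqs w) eq
... | s , s∈ , iso with orderIso-1243⁻ s iso
... | a , b , c , d , t , rest = a , b , c , d , ⊆-trans t (subseqs-⊆ w s∈) , rest

containsᵇ-1243⁺ : ∀ {w} → Contains1243 w → containsᵇ w p1243 ≡ true
containsᵇ-1243⁺ (a , b , c , d , s , a<b , b<d , d≤c) =
  any-true⁺ (orderIsoᵇ p1243) (⊆-subseqs s) (orderIso-1243⁺ {a} {b} {c} {d} a<b b<d d≤c)

avoids : List ℕ → Bool
avoids = avoidsᵇ (p4123 ∷ p1243 ∷ [])

avoids-true : ∀ {w} → ¬ Bad w → avoids w ≡ true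
avoids-true {w} ¬bad with containsᵇ w p4123 in e₁ | containsᵇ w p1243 in e₂
... | true  | _     = contradiction (inj₁ (containsᵇ-4123⁻ w e₁)) ¬bad
... | false | true  = contradiction (inj₂ (containsᵇ-1243⁻ w e₂)) ¬bad
... | false | false = refl

avoids-false : ∀ {w} → Bad w → avoids w ≡ false
avoids-false (inj₁ p) rewrite containsᵇ-4123⁺ p = refl
avoids-false {w} (inj₂ p) rewrite containsᵇ-1243⁺ p with containsᵇ w p4123
... | true  = refl
... | false = refl

private variable
  n c : ℕ
  rp m q w xs ys : List ℕ

-- Subwords of a word with an inserted maximum

Below : ℕ → List ℕ → Set
Below n = All (_< n)

insert-⊆ : ∀ m → m ++ q ⊆ m ++ n ∷ q
insert-⊆ m = ++⁺ (⊆-refl {x = m}) (_ ∷ʳ ⊆-refl)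

insertʳ-⊆ : ∀ rp → rp ʳ++ q ⊆ rp ʳ++ n ∷ q
insertʳ-⊆ rp = ʳ++⁺ (⊆-refl {x = rp}) (_ ∷ʳ ⊆-refl)

suffix-⊆ : ∀ rp → q ⊆ rp ʳ++ q
suffix-⊆ rp = ʳ++⁺ (minimum rp) ⊆-refl

drop-⊆ : ∀ xs → Below n w → w ⊆ xs ++ n ∷ ys → w ⊆ xs ++ ys
drop-⊆ []       _            (_ ∷ʳ s)   = s
drop-⊆ []       (n<n ∷ _)    (refl ∷ s) = contradiction n<n (ℕₚ.<-irrefl refl)
drop-⊆ (x ∷ xs) below        (_ ∷ʳ s)   = x ∷ʳ drop-⊆ xs below s
drop-⊆ (x ∷ xs) (_ ∷ below)  (refl ∷ s) = refl ∷ drop-⊆ xs below s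

before-last-⊆ : ∀ m → Below n q → w ++ n ∷ [] ⊆ m ++ n ∷ q → w ⊆ m
before-last-⊆ {w = []} m below s = minimum m
before-last-⊆ {n} {q} {x ∷ w} [] below s = contradiction (All-resp-⊆ (last⊆ s) below) λ { (n<n ∷ []) → ℕₚ.<-irrefl refl n<n }
  where
  last⊆ : x ∷ w ++ n ∷ [] ⊆ n ∷ q → n ∷ [] ⊆ q
  last⊆ (_ ∷ʳ s) = ⊆-trans (++⁺ˡ (x ∷ w) ⊆-refl) s
  last⊆ (_ ∷ s)  = ⊆-trans (++⁺ˡ w ⊆-refl) s
before-last-⊆ {w = x ∷ w} (y ∷ m) below (_ ∷ʳ s)   = y ∷ʳ before-last-⊆ m below s
before-last-⊆ {w = x ∷ w} (y ∷ m) below (refl ∷ s) = refl ∷ before-last-⊆ m below s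

split-⊆ : ∀ rp → w ⊆ rp ʳ++ q → ∃₂ λ u v → w ≡ u ʳ++ v × u ⊆ rp × v ⊆ q
split-⊆ []       s = [] , _ , refl , [] , s
split-⊆ (x ∷ rp) s with split-⊆ rp s
... | u , v     , eq , u⊆ , _ ∷ʳ v⊆   = u , v , eq , x ∷ʳ u⊆ , v⊆
... | u , x ∷ v , eq , u⊆ , refl ∷ v⊆ = x ∷ u , v , eq , refl ∷ u⊆ , v⊆

contains12-mono : xs ⊆ ys → Contains12 xs → Contains12 ys
contains12-mono s (a , b , t , a<b) = a , b , ⊆-trans t s , a<b

contains12ʳ-mono : xs ⊆ ys → Contains12ʳ xs → Contains12ʳ ys
contains12ʳ-mono s (a , b , t , a<b) = a , b , ⊆-trans t s , a<b

contains123-mono : xs ⊆ ys → Contains123 xs → Contains123 ys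
contains123-mono s (a , b , c , t , rest) = a , b , c , ⊆-trans t s , rest

bad-mono : xs ⊆ ys → Bad xs → Bad ys
bad-mono s (inj₁ (a , b , c , d , t , rest)) = inj₁ (a , b , c , d , ⊆-trans t s , rest)
bad-mono s (inj₂ (a , b , c , d , t , rest)) = inj₂ (a , b , c , d , ⊆-trans t s , rest)

bad⇒contains123 : Bad w → Contains123 w
bad⇒contains123 (inj₁ (a , b , c , d , s , b<c , c<d , _)) = b , c , d , ⊆-trans (a ∷ʳ ⊆-refl) s , b<c , c<d
bad⇒contains123 (inj₂ (a , b , c , d , s , a<b , b<d , d≤c)) =
  a , b , c , ⊆-trans (refl ∷ refl ∷ refl ∷ d ∷ʳ []) s , a<b , ℕₚ.<-≤-trans b<d d≤c

-- A position is a pair (rp , q), rp being the part before it in reverse, so that (x ∷ rp) ʳ++ q and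
-- rp ʳ++ (x ∷ q) are definitionally the same word.
Dead : List ℕ → List ℕ → Set
Dead rp q = Contains123 q
          ⊎ ∃ λ a → ∃₂ λ b c → (b ∷ a ∷ []) ⊆ rp × (c ∷ []) ⊆ q × a < b × b < c

dead-mono : ∀ {rp rp′ q q′} → rp ⊆ rp′ → q ⊆ q′ → Dead rp q → Dead rp′ q′
dead-mono s t (inj₁ p)                              = inj₁ (contains123-mono t p)
dead-mono s t (inj₂ (a , b , c , ab , c∈ , a<b , b<c)) = inj₂ (a , b , c , ⊆-trans ab s , ⊆-trans c∈ t , a<b , b<c)

dead⇒contains123 : Dead rp q → Contains123 (rp ʳ++ q)
dead⇒contains123 {rp} (inj₁ p) = contains123-mono (suffix-⊆ rp) p
dead⇒contains123 (inj₂ (a , b , c , ab , c∈ , a<b , b<c)) = a , b , c , ʳ++⁺ ab c∈ , a<b , b<c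

-- The maximum plays the 4: in front of a 123 it completes 4123, between a 12 and a larger entry it
-- completes 1243.
dead⇒bad : Below n (rp ʳ++ q) → Dead rp q → Bad (rp ʳ++ n ∷ q)
dead⇒bad {n} {rp} {q} below (inj₁ (a , b , c , s , a<b , b<c)) =
  inj₁ (n , a , b , c , ʳ++⁺ (minimum rp) (refl ∷ s) , a<b , b<c , c≤n)
  where
  c≤n : c ≤ n
  c≤n with _ ∷ _ ∷ c<n ∷ [] ← All-resp-⊆ (⊆-trans s (suffix-⊆ rp)) below = ℕₚ.<⇒≤ c<n
dead⇒bad {n} {rp} {q} below (inj₂ (a , b , c , ab , c∈ , a<b , b<c)) =
  inj₂ (a , b , n , c , ʳ++⁺ ab (refl ∷ c∈) , a<b , b<c , c≤n)
  where
  c≤n : c ≤ n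
  c≤n with c<n ∷ [] ← All-resp-⊆ (⊆-trans c∈ (suffix-⊆ rp)) below = ℕₚ.<⇒≤ c<n

length-before : ∀ {ws vs : List ℕ} {v} us → ws ≡ us ʳ++ v ∷ vs → length us < length ws
length-before us eq =
  subst (length us <_) (sym (trans (cong length eq) (Listₚ.length-ʳ++ us))) (ℕₚ.m<m+n (length us) (s≤s z≤n))

-- The length of `u`, the part of an occurrence before n, tells which letter n plays. Maximality
-- leaves only the 4, which gives exactly the two alternatives of `Dead`.
¬bad-insert : Below n (rp ʳ++ q) → ¬ Dead rp q → ¬ Bad (rp ʳ++ q) → ¬ Bad (rp ʳ++ n ∷ q)
¬bad-insert {n} {rp} {q} below alive ¬bad = [ ¬4123 , ¬1243 ]′
  where
  right : ∀ {v} → v ⊆ q → Below n v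
  right v⊆q = All-resp-⊆ (⊆-trans v⊆q (suffix-⊆ rp)) below
  left : ∀ {u} → u ⊆ rp → Below n (u ʳ++ [])
  left u⊆rp = All-resp-⊆ (ʳ++⁺ u⊆rp (minimum q)) below
  ¬4123 : ¬ Contains4123 (rp ʳ++ n ∷ q)
  ¬4123 (a , b , c , d , s , b<c , c<d , d≤a) with split-⊆ rp s
  ... | u , v , eq , u⊆ , _ ∷ʳ v⊆ =
    ¬bad (inj₁ (a , b , c , d , subst (_⊆ rp ʳ++ q) (sym eq) (ʳ++⁺ u⊆ v⊆) , b<c , c<d , d≤a))
  ... | [] , _ , refl , _ , refl ∷ v⊆ = alive (inj₁ (b , c , d , v⊆ , b<c , c<d))
  ... | _ ∷ [] , _ , refl , _ , refl ∷ v⊆ with c<n ∷ _ ← right v⊆ = ℕₚ.<-asym b<c c<n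
  ... | _ ∷ _ ∷ [] , _ , refl , _ , refl ∷ v⊆ with d<n ∷ _ ← right v⊆ = ℕₚ.<-asym c<d d<n
  ... | _ ∷ _ ∷ _ ∷ [] , _ , refl , u⊆ , refl ∷ _ with a<n ∷ _ ← left u⊆ = ℕₚ.<⇒≱ a<n d≤a
  ... | us@(_ ∷ _ ∷ _ ∷ _ ∷ _) , _ , eq , _ , refl ∷ _ with length-before us eq
  ... | s≤s (s≤s (s≤s (s≤s ())))
  ¬1243 : ¬ Contains1243 (rp ʳ++ n ∷ q)
  ¬1243 (a , b , c , d , s , a<b , b<d , d≤c) with split-⊆ rp s
  ... | u , v , eq , u⊆ , _ ∷ʳ v⊆ =
    ¬bad (inj₂ (a , b , c , d , subst (_⊆ rp ʳ++ q) (sym eq) (ʳ++⁺ u⊆ v⊆) , a<b , b<d , d≤c))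
  ... | [] , _ , refl , _ , refl ∷ v⊆ with b<n ∷ _ ← right v⊆ = ℕₚ.<-asym a<b b<n
  ... | _ ∷ [] , _ , refl , _ , refl ∷ v⊆ with _ ∷ d<n ∷ _ ← right v⊆ = ℕₚ.<-asym b<d d<n
  ... | _ ∷ _ ∷ [] , _ , refl , u⊆ , refl ∷ v⊆ = alive (inj₂ (a , b , d , u⊆ , v⊆ , a<b , b<d))
  ... | _ ∷ _ ∷ _ ∷ [] , _ , refl , u⊆ , refl ∷ _ with _ ∷ _ ∷ c<n ∷ _ ← left u⊆ = ℕₚ.<⇒≱ c<n d≤c
  ... | us@(_ ∷ _ ∷ _ ∷ _ ∷ _) , _ , eq , _ , refl ∷ _ with length-before us eq
  ... | s≤s (s≤s (s≤s (s≤s ())))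

all-ʳ++⁻ : ∀ {P : ℕ → Set} rp → All P (rp ʳ++ q) → All P rp × All P q
all-ʳ++⁻ []       ps = [] , ps
all-ʳ++⁻ (x ∷ rp) ps with prp , px ∷ pq ← all-ʳ++⁻ rp ps = px ∷ prp , pq

all-ʳ++⁺ : ∀ {P : ℕ → Set} {rp} → All P rp → All P q → All P (rp ʳ++ q)
all-ʳ++⁺ []         pq = pq
all-ʳ++⁺ (px ∷ prp) pq = all-ʳ++⁺ prp (px ∷ pq)

below-insert : ∀ rp → Below n (rp ʳ++ q) → Below (suc n) (rp ʳ++ n ∷ q)
below-insert rp below with prp , pq ← all-ʳ++⁻ rp below =
  all-ʳ++⁺ (All.map ℕₚ.m<n⇒m<1+n prp) (ℕₚ.n<1+n _ ∷ All.map ℕₚ.m<n⇒m<1+n pq)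

-- An ascent a < b before the position with a larger c after it cannot use n, since b < c < n.
alive-right : ∀ rp → Below n q → ¬ Dead (rp ++ xs) q → ¬ Dead (rp ++ n ∷ xs) q
alive-right rp below alive (inj₁ p) = alive (inj₁ p)
alive-right rp below alive (inj₂ (a , b , c , ab , c∈ , a<b , b<c)) with c<n ∷ [] ← All-resp-⊆ c∈ below =
  alive (inj₂ (a , b , c , drop-⊆ rp (b<n ∷ ℕₚ.<-trans a<b b<n ∷ []) ab , c∈ , a<b , b<c))
  where b<n = ℕₚ.<-trans b<c c<n

-- A 123 created by n ends in n, so its 12 would lie in `m`. The other way to die requires a 12 in
-- `rp`.
alive-left : ∀ m → Below n (m ++ q) → ¬ Contains12ʳ rp → ¬ Contains12 m → ¬ Dead rp (m ++ q) → ¬ Dead rp (m ++ n ∷ q)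
alive-left m below ¬rp ¬m alive (inj₂ (a , b , c , ab , _ , a<b , _)) = ¬rp (a , b , ab , a<b)
alive-left {n} {q} m below ¬rp ¬m alive (inj₁ (a , b , c , s , a<b , b<c)) with c ℕₚ.<? n
... | yes c<n = alive (inj₁ (a , b , c , drop-⊆ m (ℕₚ.<-trans a<b b<n ∷ b<n ∷ c<n ∷ []) s , a<b , b<c))
  where b<n = ℕₚ.<-trans b<c c<n
... | no c≮n with ℕₚ.m≤n⇒m<n∨m≡n (ℕₚ.≮⇒≥ c≮n)
... | inj₂ refl = ¬m (a , b , before-last-⊆ m (Allₚ.++⁻ʳ m below) s , a<b)
... | inj₁ n<c  = contradiction (All-resp-⊆ (⊆-trans (a ∷ʳ b ∷ʳ ⊆-refl) s) (Allₚ.++⁺ (All.map ℕₚ.m<n⇒m<1+n (Allₚ.++⁻ˡ m below))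
                                                              (ℕₚ.n<1+n n ∷ All.map ℕₚ.m<n⇒m<1+n (Allₚ.++⁻ʳ m below))))
                    λ { (c<1+n ∷ []) → ℕₚ.<⇒≱ n<c (ℕₚ.≤-pred c<1+n) }

-- LiveAfter rp q c: the positions strictly after (rp , q) comprise c live ones.
-- LiveSplit counts those inside the first part of the suffix separately.
data LiveAfter (rp : List ℕ) : List ℕ → ℕ → Set where
  []   : LiveAfter rp [] 0
  live : ∀ {x q c} → ¬ Dead (x ∷ rp) q → LiveAfter (x ∷ rp) q c → LiveAfter rp (x ∷ q) (suc c)
  dead : ∀ {x q c} → Dead (x ∷ rp) q → LiveAfter (x ∷ rp) q c → LiveAfter rp (x ∷ q) c

data LiveSplit (rp : List ℕ) : List ℕ → List ℕ → ℕ → ℕ → Set where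
  rest : ∀ {q c} → LiveAfter rp q c → LiveSplit rp [] q 0 c
  live : ∀ {x m q b c} → ¬ Dead (x ∷ rp) (m ++ q) → LiveSplit (x ∷ rp) m q b c → LiveSplit rp (x ∷ m) q (suc b) c
  dead : ∀ {x m q b c} → Dead (x ∷ rp) (m ++ q) → LiveSplit (x ∷ rp) m q b c → LiveSplit rp (x ∷ m) q b c

liveSplit⇒liveAfter : ∀ {b} → LiveSplit rp m q b c → LiveAfter rp (m ++ q) (b + c)
liveSplit⇒liveAfter (rest l)    = l
liveSplit⇒liveAfter (live ¬d l) = live ¬d (liveSplit⇒liveAfter l)
liveSplit⇒liveAfter (dead d l)  = dead d (liveSplit⇒liveAfter l)

liveAfter-insert : ∀ rp → Below n q → LiveAfter (rp ++ xs) q c → LiveAfter (rp ++ n ∷ xs) q c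
liveAfter-insert rp below       []          = []
liveAfter-insert rp (_ ∷ below) (live ¬d l) = live (alive-right (_ ∷ rp) below ¬d) (liveAfter-insert (_ ∷ rp) below l)
liveAfter-insert rp (_ ∷ below) (dead d l)  = dead (dead-mono (refl ∷ insert-⊆ rp) ⊆-refl d) (liveAfter-insert (_ ∷ rp) below l)

liveSplit-insert : ∀ {b} rp → Below n (m ++ q) → LiveSplit (rp ++ xs) m q b c → LiveSplit (rp ++ n ∷ xs) m q b c
liveSplit-insert rp below       (rest l)    = rest (liveAfter-insert rp below l)
liveSplit-insert rp (_ ∷ below) (live ¬d l) = live (alive-right (_ ∷ rp) below ¬d) (liveSplit-insert (_ ∷ rp) below l)
liveSplit-insert rp (_ ∷ below) (dead d l)  = dead (dead-mono (refl ∷ insert-⊆ rp) ⊆-refl d) (liveSplit-insert (_ ∷ rp) below l)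

liveAfter-all : ¬ Contains123 (rp ʳ++ q) → LiveAfter rp q (length q)
liveAfter-all {q = []}          ¬123 = []
liveAfter-all {rp} {q = x ∷ q} ¬123 = live (¬123 ∘ dead⇒contains123 {x ∷ rp}) (liveAfter-all {x ∷ rp} ¬123)

liveSplit-all : ∀ m → ¬ Contains123 (rp ʳ++ (m ++ q)) → LiveSplit rp m q (length m) (length q)
liveSplit-all      []      ¬123 = rest (liveAfter-all ¬123)
liveSplit-all {rp} (x ∷ m) ¬123 = live (¬123 ∘ dead⇒contains123 {x ∷ rp}) (liveSplit-all {x ∷ rp} m ¬123)

dead-by-ascent : Below n rp → Contains12ʳ rp → ∀ m → Dead rp (m ++ n ∷ q)
dead-by-ascent {n} below (a , b , s , a<b) m with b<n ∷ _ ← All-resp-⊆ s below =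
  inj₂ (a , b , n , s , ++⁺ˡ m (refl ∷ minimum _) , a<b , b<n)

DeadBefore : List ℕ → List ℕ → Set
DeadBefore []       q = ⊤
DeadBefore (x ∷ rp) q = Dead rp (x ∷ q) × DeadBefore rp (x ∷ q)

-- The position at rp is dead once a new maximum is inserted between m and q.
Killed : List ℕ → List ℕ → List ℕ → Set
Killed rp m q = Dead rp (m ++ q) ⊎ Contains12ʳ rp ⊎ Contains12 m

KilledBefore : List ℕ → List ℕ → List ℕ → Set
KilledBefore []       m q = ⊤
KilledBefore (x ∷ rp) m q = Killed rp (x ∷ m) q × KilledBefore rp (x ∷ m) q

killed-dead : Below n (rp ʳ++ m ++ q) → Killed rp m q → Dead rp (m ++ n ∷ q)
killed-dead {rp = rp} {m} below (inj₁ d)        = dead-mono (⊆-refl {x = rp}) (insert-⊆ m) d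
killed-dead {rp = rp} {m} below (inj₂ (inj₁ p)) = dead-by-ascent (proj₁ (all-ʳ++⁻ rp below)) p m
killed-dead {n} {rp} {m} {q} below (inj₂ (inj₂ (a , b , s , a<b)))
  with _ ∷ b<n ∷ [] ← All-resp-⊆ s (Allₚ.++⁻ˡ m (proj₂ (all-ʳ++⁻ rp below))) =
  inj₁ (a , b , n , ++⁺ s (refl ∷ minimum q) , a<b , b<n)

killedBefore-dead : ∀ rp → Below n (rp ʳ++ m ++ q) → KilledBefore rp m q → DeadBefore rp (m ++ n ∷ q)
killedBefore-dead []       below _        = tt
killedBefore-dead (x ∷ rp) below (k , ks) = killed-dead {rp = rp} {x ∷ _} below k , killedBefore-dead rp below ks

deadBefore-killed : ∀ rp → DeadBefore rp (m ++ q) → KilledBefore rp m q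
deadBefore-killed []       _        = tt
deadBefore-killed (x ∷ rp) (d , ds) = inj₁ d , deadBefore-killed rp ds

killed-extend : ∀ v → Killed rp m (v ++ q) → Killed rp (m ++ v) q
killed-extend {rp} {m} {q} v (inj₁ d)        = inj₁ (subst (Dead rp) (sym (Listₚ.++-assoc m v q)) d)
killed-extend             v (inj₂ (inj₁ p)) = inj₂ (inj₁ p)
killed-extend             v (inj₂ (inj₂ p)) = inj₂ (inj₂ (contains12-mono (++⁺ʳ v ⊆-refl) p))

killedBefore-extend : ∀ rp v → KilledBefore rp m (v ++ q) → KilledBefore rp (m ++ v) q
killedBefore-extend []       v _        = tt
killedBefore-extend (x ∷ rp) v (k , ks) = killed-extend {rp} {x ∷ _} v k , killedBefore-extend rp v ks

killedBefore-ascent : ∀ rp → Contains12 m → KilledBefore rp m q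
killedBefore-ascent []       p = tt
killedBefore-ascent (x ∷ rp) p = inj₂ (inj₂ p′) , killedBefore-ascent rp p′
  where p′ = contains12-mono (x ∷ʳ ⊆-refl) p

-- Every position passed on the way over `v` already has the 12 of `rp` before it.
killedBefore-move : ∀ v → Contains12ʳ rp → KilledBefore rp (v ++ m) q → KilledBefore (v ʳ++ rp) m q
killedBefore-move []      p ks = ks
killedBefore-move (y ∷ v) p ks = killedBefore-move v (contains12ʳ-mono (y ∷ʳ ⊆-refl) p) (inj₂ (inj₁ p) , ks)

-- Descendant counts

before after : (List ℕ → List ℕ → ℕ) → List ℕ → List ℕ → ℕ
before f []       q = 0
before f (x ∷ rp) q = before f rp (x ∷ q) + f rp (x ∷ q)
after f rp []      = 0
after f rp (x ∷ q) = f (x ∷ rp) q + after f (x ∷ rp) q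

before-after : ∀ f rp q → before f rp q + (f rp q + after f rp q) ≡ f [] (rp ʳ++ q) + after f [] (rp ʳ++ q)
before-after f []       q = refl
before-after f (x ∷ rp) q = trans (ℕₚ.+-assoc (before f rp (x ∷ q)) _ _) (before-after f rp (x ∷ q))

-- Only the final words are tested; this makes the sum over all permutations of a given length a
-- plain unfolding.
descendants : ℕ → ℕ → List ℕ → ℕ
descendants zero    n w = if avoids w then 1 else 0
descendants (suc k) n w = f [] w + after f [] w
  where f = λ rp q → descendants k (suc n) (rp ʳ++ n ∷ q)

child : ℕ → ℕ → List ℕ → List ℕ → ℕ
child k n rp q = descendants k (suc n) (rp ʳ++ n ∷ q)

descendants-at : ∀ k n rp q → descendants (suc k) n (rp ʳ++ q)
  ≡ before (child k n) rp q + (child k n rp q + after (child k n) rp q)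
descendants-at k n rp q = sym (before-after (child k n) rp q)

after-zero : ∀ f rp q → (∀ rp′ q′ → rp′ ʳ++ q′ ≡ rp ʳ++ q → f rp′ q′ ≡ 0) → after f rp q ≡ 0
after-zero f rp []      h = refl
after-zero f rp (x ∷ q) h = cong₂ _+_ (h (x ∷ rp) q refl) (after-zero f (x ∷ rp) q h)

bad-descendants : ∀ k n {w} → Bad w → descendants k n w ≡ 0
bad-descendants zero    n bad rewrite avoids-false bad = refl
bad-descendants (suc k) n {w} bad = cong₂ _+_ (bad-child [] w refl) (after-zero (child k n) [] w bad-child)
  where
  bad-child : ∀ rp q → rp ʳ++ q ≡ w → child k n rp q ≡ 0
  bad-child rp q refl = bad-descendants k (suc n) (bad-mono (insertʳ-⊆ rp) bad)

dead-child : ∀ k rp → Below n (rp ʳ++ q) → Dead rp q → child k n rp q ≡ 0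
dead-child k rp below d = bad-descendants k _ (dead⇒bad below d)

deadBefore-child : ∀ k rp → Below n (rp ʳ++ q) → DeadBefore rp q → before (child k n) rp q ≡ 0
deadBefore-child k []       below _        = refl
deadBefore-child k (x ∷ rp) below (d , ds) = cong₂ _+_ (deadBefore-child k rp below ds) (dead-child k rp below d)

good-descendants : ∀ n {w} → ¬ Bad w → descendants 0 n w ≡ 1
good-descendants n ¬bad rewrite avoids-true ¬bad = refl

KilledAt : List ℕ → List ℕ → Set
KilledAt rp q = Contains12ʳ rp × KilledBefore rp [] q

killedAt-step : ∀ {x} → KilledAt rp (x ∷ q) → KilledAt (x ∷ rp) q
killedAt-step {rp} {x = x} (p , ks) =
  contains12ʳ-mono (x ∷ʳ ⊆-refl) p , inj₂ (inj₁ p) , killedBefore-extend rp (x ∷ []) ks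

-- (rp , q) is a marker at or before which everything is dead. In the recursive use it stands just
-- before the maximum inserted last.
CountF : ℕ → Set
CountF k = ∀ {n rp q c} → Below n (rp ʳ++ q) → ¬ Bad (rp ʳ++ q) → Contains12ʳ rp → Dead rp q → DeadBefore rp q →
  LiveAfter rp q c → descendants k n (rp ʳ++ q) ≡ treeF k c

-- `start` speaks of the next position only: at (rp , q) itself there need not be a 12 in `rp`, as
-- when this position lies between the two runs and nothing follows.
after-killing : ∀ k → CountF k → Below n (rp ʳ++ q) → ¬ Bad (rp ʳ++ q) →
  (∀ {x q′} → q ≡ x ∷ q′ → KilledAt (x ∷ rp) q′) → LiveAfter rp q c →
  after (child k n) rp q ≡ sum< c (λ j → treeF k (suc j))
after-killing k count below ¬bad start [] = refl
after-killing {rp = rp} k count below ¬bad start (dead d l) = cong₂ _+_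
  (dead-child k (_ ∷ rp) below d)
  (after-killing k count below ¬bad (λ { refl → killedAt-step (start refl) }) l)
after-killing {n} {rp} {x ∷ q} k count below ¬bad start (live ¬d l) with p , ks ← start refl = cong₂ _+_
  (count (below-insert (x ∷ rp) below) (¬bad-insert {rp = x ∷ rp} below ¬d ¬bad) p
    (dead-by-ascent (proj₁ (all-ʳ++⁻ (x ∷ rp) below)) p []) (killedBefore-dead (x ∷ rp) below ks)
    -- The position just right of the new maximum inherits the liveness of the one that received it,
    -- whence `suc j`.
    (live (alive-right [] below-q ¬d) (liveAfter-insert [] below-q l)))
  (after-killing k count below ¬bad (λ { refl → killedAt-step (p , ks) }) l)
  where below-q = proj₂ (all-ʳ++⁻ (x ∷ rp) below)

countF : ∀ k → CountF k
countF zero {n} below ¬bad p d ds l = good-descendants n ¬bad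
countF (suc k) {n} {rp} {q} below ¬bad p d ds l = trans (descendants-at k n rp q) (cong₂ _+_
  (deadBefore-child k rp below ds)
  (cong₂ _+_ (dead-child k rp below d)
    (after-killing k (countF k) below ¬bad (λ { refl → killedAt-step (p , deadBefore-killed rp ds) }) l)))

-- A word is written D ++ E ++ R with reverse D = x ∷ rd: D and E are its first two descending runs.
record Runs (x : ℕ) (rd e r : List ℕ) : Set where
  field
    descending₁ : ¬ Contains12ʳ (x ∷ rd)
    descending₂ : ¬ Contains12 e
    ascent₁     : ∀ {y e′} → e ≡ y ∷ e′ → x < y
    ascent₂     : ∀ {y r′} → r ≡ y ∷ r′ → Contains12 (e ++ y ∷ [])

liveSplit-dead : ∀ m → Below n (m ʳ++ rp) → Contains12ʳ rp → LiveAfter (m ʳ++ rp) (n ∷ q) c → LiveSplit rp m (n ∷ q) 0 c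
liveSplit-dead []       below p l = rest l
liveSplit-dead (y ∷ m) below p l =
  dead (dead-by-ascent (proj₂ (all-ʳ++⁻ m below)) p′ m) (liveSplit-dead m below p′ l)
  where p′ = contains12ʳ-mono (y ∷ʳ ⊆-refl) p

-- Words whose first live position is between the first two runs

CountE : ℕ → Set
CountE k = ∀ {n x rd e r b c} → Runs x rd e r → Below n ((x ∷ rd) ʳ++ e ++ r) → ¬ Bad ((x ∷ rd) ʳ++ e ++ r) →
  ¬ Dead (x ∷ rd) (e ++ r) → DeadBefore (x ∷ rd) (e ++ r) → LiveSplit (x ∷ rd) e r b c →
  descendants k n ((x ∷ rd) ʳ++ e ++ r) ≡ treeE k b c

-- Insertions behind the first run, treated once for `countE` and `countA`. The hypothesis `killed`
-- holds in the former because the earlier positions are dead already, in the latter because of the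
-- ascent from x to y.
module _ (k : ℕ) (count : CountE k) {n x : ℕ} {rd e r : List ℕ} (runs : Runs x rd e r) (alive : ¬ Dead (x ∷ rd) (e ++ r))
         (killed : ∀ {y e′} → e ≡ y ∷ e′ → KilledBefore (x ∷ rd) (y ∷ []) (e′ ++ r)) where
  open Runs runs

  -- The entries y ∷ e₁ become the new second run. It is descending, so the position in front of it
  -- survives; positions inside it have x < y before them and n after them, whence the 0. Everything
  -- from n on belongs to the rest.
  child-in-second-run : ∀ y e₁ e₂ {cur c} → cur ≡ (y ∷ e₁) ʳ++ x ∷ rd → (y ∷ e₁) ++ e₂ ≡ e →
    Below n (cur ʳ++ e₂ ++ r) → ¬ Bad (cur ʳ++ e₂ ++ r) → ¬ Dead cur (e₂ ++ r) → LiveAfter cur (e₂ ++ r) c →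
    child k n cur (e₂ ++ r) ≡ treeE k 0 (suc c)
  child-in-second-run y e₁ e₂ refl refl below ¬bad ¬d l = trans
    (cong (descendants k (suc n)) (Listₚ.ʳ++-ʳ++ (y ∷ e₁) {x ∷ rd}))
    (count runs′
      (subst (Below (suc n)) (Listₚ.ʳ++-ʳ++ (y ∷ e₁) {x ∷ rd}) (below-insert cur below))
      (λ bad → ¬bad-insert {rp = cur} below ¬d ¬bad (subst Bad (sym (Listₚ.ʳ++-ʳ++ (y ∷ e₁) {x ∷ rd})) bad))
      (alive-left (y ∷ e₁) (proj₂ (all-ʳ++⁻ (x ∷ rd) below-e)) descending₁ descending₂′
        (alive ∘ subst (Dead (x ∷ rd)) (cong (y ∷_) (sym (Listₚ.++-assoc e₁ e₂ r)))))
      (killedBefore-dead (x ∷ rd) below-e (killedBefore-extend (x ∷ rd) e₁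
        (subst (KilledBefore (x ∷ rd) (y ∷ [])) (Listₚ.++-assoc e₁ e₂ r) (killed refl))))
      (dead (dead-by-ascent (proj₂ (all-ʳ++⁻ e₁ below-cur)) x<y e₁)
        (liveSplit-dead e₁ below-cur x<y
          (live (alive-right [] below-q ¬d) (liveAfter-insert [] below-q l)))))
    where
    cur = e₁ ʳ++ y ∷ x ∷ rd
    below-cur = proj₁ (all-ʳ++⁻ cur below)
    below-q = proj₂ (all-ʳ++⁻ cur below)
    below-e : Below n ((x ∷ rd) ʳ++ (y ∷ e₁) ++ e₂ ++ r)
    below-e = subst (Below n) (Listₚ.ʳ++-ʳ++ (y ∷ e₁) {x ∷ rd}) below
    x<y : Contains12ʳ (y ∷ x ∷ rd)
    x<y = x , y , refl ∷ refl ∷ minimum rd , ascent₁ refl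
    y<n : y < n
    y<n with p ∷ _ ← proj₂ (all-ʳ++⁻ e₁ below-cur) = p
    descending₂′ : ¬ Contains12 (y ∷ e₁)
    descending₂′ = descending₂ ∘ contains12-mono (++⁺ʳ e₂ ⊆-refl)
    runs′ : Runs x rd (y ∷ e₁) (n ∷ e₂ ++ r)
    runs′ = record
      { descending₁ = descending₁
      ; descending₂ = descending₂′
      ; ascent₁     = λ { refl → ascent₁ refl }
      ; ascent₂     = λ { refl → y , n , refl ∷ ++⁺ˡ e₁ ⊆-refl , y<n } }

  -- Three kinds of earlier positions: those inside `e` have a 12 before them by `ascent₁`; the one
  -- between the runs gets a 12 to its right by `ascent₂`; those further left fall under `killed`.
  killedAt-rest : ∀ {y r′} → r ≡ y ∷ r′ → KilledAt (y ∷ e ʳ++ x ∷ rd) r′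
  killedAt-rest {y} {r′} refl = go e refl
    where
    go : ∀ e′ → e ≡ e′ → KilledAt (y ∷ e′ ʳ++ x ∷ rd) r′
    go [] refl with ascent₂ refl
    ... | _ , _ , _ ∷ʳ () , _
    ... | _ , _ , refl ∷ () , _
    go (z ∷ e′) refl = contains12ʳ-mono (y ∷ʳ ⊆-refl) p , inj₂ (inj₁ p)
      , killedBefore-move e′ x<z (inj₂ (inj₂ (ascent₂ refl)) ,
          killedBefore-extend (x ∷ rd) (y ∷ []) (killedBefore-extend (x ∷ rd) e′ (killed refl)))
      where
      x<z : Contains12ʳ (z ∷ x ∷ rd)
      x<z = x , z , refl ∷ refl ∷ minimum rd , ascent₁ refl
      p : Contains12ʳ (e′ ʳ++ z ∷ x ∷ rd)
      p = contains12ʳ-mono (suffix-⊆ e′) x<z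

  after-first-run : ∀ e₁ e₂ {cur b c} → cur ≡ e₁ ʳ++ x ∷ rd → e₁ ++ e₂ ≡ e →
    Below n (cur ʳ++ e₂ ++ r) → ¬ Bad (cur ʳ++ e₂ ++ r) → LiveSplit cur e₂ r b c →
    after (child k n) cur (e₂ ++ r) ≡ sum< b (λ j → treeE k 0 (suc (j + c))) + sum< c (λ j → treeF k (suc j))
  after-first-run e₁ [] refl refl below ¬bad (rest l) =
    after-killing k (countF k) below ¬bad
      (λ eq → subst (λ e → KilledAt (_ ∷ e ʳ++ x ∷ rd) _) (Listₚ.++-identityʳ e₁) (killedAt-rest eq)) l
  after-first-run e₁ (y ∷ e₂) {cur} refl refl below ¬bad (dead d l) = cong₂ _+_
    (dead-child k (y ∷ cur) below d)
    (after-first-run (e₁ ++ y ∷ []) e₂ (sym (Listₚ.++-ʳ++ e₁)) (Listₚ.++-assoc e₁ _ _) below ¬bad l)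
  after-first-run e₁ (y ∷ e₂) {cur} refl refl below ¬bad (live {b = b} {c} ¬d l) = trans
    (cong₂ _+_ (at-child e₁ refl)
      (after-first-run (e₁ ++ y ∷ []) e₂ (sym (Listₚ.++-ʳ++ e₁)) (Listₚ.++-assoc e₁ _ _) below ¬bad l))
    (sym (ℕₚ.+-assoc (treeE k 0 (suc (b + c))) _ _))
    where
    at-child : ∀ e′ → e₁ ≡ e′ → child k n (y ∷ cur) (e₂ ++ r) ≡ treeE k 0 (suc (b + c))
    at-child []       refl = child-in-second-run y [] e₂ refl refl below ¬bad ¬d (liveSplit⇒liveAfter l)
    at-child (w ∷ e′) refl = child-in-second-run w (e′ ++ y ∷ []) e₂ (sym (Listₚ.++-ʳ++ e′))
      (cong (w ∷_) (Listₚ.++-assoc e′ _ _)) below ¬bad ¬d (liveSplit⇒liveAfter l)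

runs-insert : ∀ {x rd e r} → x < n → Below n e → Runs x rd e r → Runs x rd (n ∷ e) r
runs-insert x<n below runs = record
  { descending₁ = descending₁
  ; descending₂ = λ { (a , b , _ ∷ʳ s , a<b) → descending₂ (a , b , s , a<b)
                    ; (a , b , refl ∷ s , n<b) → contradiction (All-resp-⊆ s below) λ { (b<n ∷ []) → ℕₚ.<-asym n<b b<n } }
  ; ascent₁     = λ { refl → x<n }
  ; ascent₂     = contains12-mono (_ ∷ʳ ⊆-refl) ∘ ascent₂ }
  where open Runs runs

countE : ∀ k → CountE k
countE zero {n} runs below ¬bad alive ds l = good-descendants n ¬bad
countE (suc k) {n} {x} {rd} {e} {r} runs below ¬bad alive ds l = trans (descendants-at k n (x ∷ rd) (e ++ r)) (cong₂ _+_
  (deadBefore-child k (x ∷ rd) below ds)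
  (cong₂ _+_
    -- The maximum heads the second run, and the positions on both sides of it are live.
    (countE k {e = n ∷ e} (runs-insert x<n (Allₚ.++⁻ˡ e below-q) runs) (below-insert (x ∷ rd) below)
      (¬bad-insert {rp = x ∷ rd} below alive ¬bad)
      (alive-left [] below-q (Runs.descending₁ runs) (λ { (_ , _ , () , _) }) alive)
      (killedBefore-dead {m = []} (x ∷ rd) below (deadBefore-killed (x ∷ rd) ds))
      (live (alive-right [] below-q alive) (liveSplit-insert [] below-q l)))
    (after-first-run k (countE k) runs alive
      (λ { refl → deadBefore-killed (x ∷ rd) ds }) [] e refl refl below ¬bad l)))
  where
  below-q = proj₂ (all-ʳ++⁻ (x ∷ rd) below)
  x<n : x < n
  x<n with p ∷ _ ← proj₁ (all-ʳ++⁻ (x ∷ rd) below) = p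

-- Words avoiding 123

¬123-insert : ¬ Contains12ʳ rp → Below n (rp ʳ++ q) → ¬ Contains123 (rp ʳ++ q) → ¬ Contains123 (rp ʳ++ n ∷ q)
¬123-insert {rp} ¬rp below ¬123 (a , b , c , s , a<b , b<c) with split-⊆ rp s
... | u , v , eq , u⊆ , _ ∷ʳ v⊆ = ¬123 (a , b , c , subst (_⊆ rp ʳ++ _) (sym eq) (ʳ++⁺ u⊆ v⊆) , a<b , b<c)
... | [] , _ , refl , _ , refl ∷ v⊆ with b<n ∷ _ ← All-resp-⊆ (⊆-trans v⊆ (suffix-⊆ rp)) below = ℕₚ.<-asym a<b b<n
... | _ ∷ [] , _ , refl , _ , refl ∷ v⊆ with c<n ∷ _ ← All-resp-⊆ (⊆-trans v⊆ (suffix-⊆ rp)) below = ℕₚ.<-asym b<c c<n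
... | _ ∷ _ ∷ [] , _ , refl , u⊆ , refl ∷ _ = ¬rp (a , b , u⊆ , a<b)
... | us@(_ ∷ _ ∷ _ ∷ _) , _ , eq , _ , refl ∷ _ with length-before us eq
... | s≤s (s≤s (s≤s ()))

contains12ʳ-append : Below n w → Contains12ʳ (w ++ n ∷ []) → Contains12ʳ w
contains12ʳ-append {n} {w} below (a , b , s , a<b) =
  a , b , subst (_ ⊆_) (Listₚ.++-identityʳ w) (drop-⊆ w (b<n ∷ ℕₚ.<-trans a<b b<n ∷ []) s) , a<b
  where
  head<n : ∀ w → Below n w → (b ∷ a ∷ []) ⊆ w ++ n ∷ [] → b < n
  head<n []      below       (_ ∷ʳ ())
  head<n []      below       (refl ∷ ())
  head<n (y ∷ w) (_ ∷ below) (_ ∷ʳ s)   = head<n w below s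
  head<n (y ∷ w) (y<n ∷ _)   (refl ∷ _) = y<n
  b<n = head<n w below s

CountA : ℕ → Set
CountA k = ∀ {n x rd e r} → Runs x rd e r → Below n ((x ∷ rd) ʳ++ e ++ r) → ¬ Contains123 ((x ∷ rd) ʳ++ e ++ r) →
  descendants k n ((x ∷ rd) ʳ++ e ++ r) ≡ treeA k (length rd) (length e) (length r)

module _ (k : ℕ) (count : CountA k) {n : ℕ} where

  -- `m` collects the entries of the first run already passed from the right. A maximum in front of
  -- x ∷ m opens a new second run n ∷ x ∷ m, and the old word from `t` on becomes the rest. The
  -- front position is kept apart, since there the first run grows instead.
  before-first-run : ∀ x rd m t → ¬ Contains12ʳ (m ʳ++ x ∷ rd) → (∀ {y t′} → t ≡ y ∷ t′ → Contains12 ((x ∷ m) ++ y ∷ [])) →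
    Below n ((x ∷ rd) ʳ++ m ++ t) → ¬ Contains123 ((x ∷ rd) ʳ++ m ++ t) →
    before (child k n) (x ∷ rd) (m ++ t)
      ≡ child k n [] ((x ∷ rd) ʳ++ m ++ t) + antidiagonal (λ i j → treeA k i j (length t)) (length rd) (length m)
  before-first-run x [] m t desc asc below ¬123 = sym (ℕₚ.+-identityʳ _)
  before-first-run x (y ∷ rd) m t desc asc below ¬123 = trans
    (cong₂ _+_
      (before-first-run y rd (x ∷ m) t desc (contains12-mono (y ∷ʳ ⊆-refl) ∘ asc) below ¬123)
      (count {e = n ∷ x ∷ m} runs′ (below-insert (y ∷ rd) below) (¬123-insert {rp = y ∷ rd} desc′ below ¬123)))
    (ℕₚ.+-assoc (child k n [] ((x ∷ y ∷ rd) ʳ++ m ++ t)) _ _)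
    where
    desc′ : ¬ Contains12ʳ (y ∷ rd)
    desc′ = desc ∘ contains12ʳ-mono (suffix-⊆ (x ∷ m))
    below′ = all-ʳ++⁻ (y ∷ rd) below
    y<n : y < n
    y<n with p ∷ _ ← proj₁ below′ = p
    runs′ : Runs y rd (n ∷ x ∷ m) t
    runs′ = record
      { descending₁ = desc′
      ; descending₂ = λ
        { (a , b , _ ∷ʳ s , a<b) → desc (a , b , ʳ++⁺ s (minimum (y ∷ rd)) , a<b)
        ; (a , b , refl ∷ s , n<b) → contradiction (All-resp-⊆ s (Allₚ.++⁻ˡ (x ∷ m) (proj₂ below′)))
            λ { (b<n ∷ []) → ℕₚ.<-asym n<b b<n } }
      ; ascent₁     = λ { refl → y<n }
      ; ascent₂     = contains12-mono (_ ∷ʳ ⊆-refl) ∘ asc }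

countA : ∀ k → CountA k
countA zero {n} runs below ¬123 = good-descendants n (¬123 ∘ bad⇒contains123)
countA (suc k) {n} {x} {rd} {e} {r} runs below ¬123 = trans (descendants-at k n (x ∷ rd) (e ++ r)) (cong₂ _+_
  (trans (before-first-run k (countA k) x rd [] (e ++ r) descending₁ ascent below ¬123)
    (cong₂ _+_ first (cong (λ l → antidiagonal (λ i j → treeA k i j l) (length rd) 0) (Listₚ.length-++ e))))
  (cong₂ _+_
    (countA k {e = n ∷ e} (runs-insert x<n (Allₚ.++⁻ˡ e (proj₂ below′)) runs) (below-insert (x ∷ rd) below)
      (¬123-insert {rp = x ∷ rd} descending₁ below ¬123))
    (after-first-run k (countE k) runs (¬123 ∘ dead⇒contains123 {x ∷ rd})
      -- All positions of the first run are still live here; the ascent from x to the head of `e` is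
      -- what kills them.
      (λ { refl → let p = x , _ , ⊆-refl , ascent₁ refl in inj₂ (inj₂ p) , killedBefore-ascent rd p }) [] e refl refl below
      (¬123 ∘ bad⇒contains123) (liveSplit-all e ¬123))))
  where
  open Runs runs
  below′ = all-ʳ++⁻ (x ∷ rd) below
  x<n : x < n
  x<n with p ∷ _ ← proj₁ below′ = p
  ascent : ∀ {y t} → e ++ r ≡ y ∷ t → Contains12 (x ∷ y ∷ [])
  ascent = go e refl
    where
    go : ∀ e′ → e ≡ e′ → ∀ {y t} → e′ ++ r ≡ y ∷ t → Contains12 (x ∷ y ∷ [])
    go []       refl eq with ascent₂ eq
    ... | _ , _ , _ ∷ʳ () , _
    ... | _ , _ , refl ∷ () , _
    go (z ∷ e′) refl refl = x , z , ⊆-refl , ascent₁ refl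
  first : child k n [] ((x ∷ rd) ʳ++ e ++ r) ≡ treeA k (suc (length rd)) (length e) (length r)
  first = trans (cong (descendants k (suc n)) (sym word))
    (trans (countA k runs′ (subst (Below (suc n)) (sym word) (below-insert [] below))
             (¬123-insert {rp = []} (λ { (_ , _ , () , _) }) below ¬123 ∘ subst Contains123 word))
      (cong (λ l → treeA k l (length e) (length r)) (trans (Listₚ.length-++ rd) (ℕₚ.+-comm (length rd) 1))))
    where
    word : (x ∷ rd ++ n ∷ []) ʳ++ e ++ r ≡ n ∷ ((x ∷ rd) ʳ++ e ++ r)
    word = Listₚ.++-ʳ++ (x ∷ rd)
    -- The first run is stored reversed, so growth at the front appends n to `rd`.
    runs′ : Runs x (rd ++ n ∷ []) e r
    runs′ = record { descending₁ = descending₁ ∘ contains12ʳ-append (proj₁ below′)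
                   ; descending₂ = descending₂ ; ascent₁ = ascent₁ ; ascent₂ = ascent₂ }

-- The empty word has no first run; the tree starts at the word of length one.
descendants-root : ∀ k → descendants (suc k) 0 [] ≡ treeA k 0 0 0
descendants-root k = trans (ℕₚ.+-identityʳ _)
  (countA k {x = 0} {[]} {[]} {[]}
    (record { descending₁ = λ { (_ , _ , _ ∷ʳ () , _) ; (_ , _ , refl ∷ () , _) } ; descending₂ = λ { (_ , _ , () , _) }
            ; ascent₁ = λ () ; ascent₂ = λ () })
    (s≤s z≤n ∷ []) λ { (_ , _ , _ , _ ∷ʳ () , _) ; (_ , _ , _ , refl ∷ () , _) })

-- Enumeration of permutations

children : ℕ → List ℕ → List ℕ → List (List ℕ)
children n rp []      = (rp ʳ++ n ∷ []) ∷ []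
children n rp (x ∷ q) = (rp ʳ++ n ∷ x ∷ q) ∷ children n (x ∷ rp) q

perms : ℕ → List (List ℕ)
perms zero    = [] ∷ []
perms (suc n) = concatMap (children n []) (perms n)

∈-children⁺ : ∀ {n} p {rp q} → rp ʳ++ p ++ n ∷ q ∈ children n rp (p ++ q)
∈-children⁺ []      {q = []}    = here refl
∈-children⁺ []      {q = x ∷ q} = here refl
∈-children⁺ (x ∷ p) {rp}        = there (∈-children⁺ p {x ∷ rp})

∈-children⁻ : ∀ {n} rp q {w} → w ∈ children n rp q → ∃₂ λ p s → w ≡ rp ʳ++ p ++ n ∷ s × p ++ s ≡ q
∈-children⁻ rp []      (here refl) = [] , [] , refl , refl
∈-children⁻ rp (x ∷ q) (here refl) = [] , x ∷ q , refl , refl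
∈-children⁻ rp (x ∷ q) (there w∈) with p , s , refl , refl ← ∈-children⁻ (x ∷ rp) q w∈ = x ∷ p , s , refl , refl

ʳ++-cancelˡ : ∀ {A : Set} (rp : List A) {xs ys} → rp ʳ++ xs ≡ rp ʳ++ ys → xs ≡ ys
ʳ++-cancelˡ []       eq = eq
ʳ++-cancelˡ (x ∷ rp) eq = Listₚ.∷-injectiveʳ (ʳ++-cancelˡ rp eq)

children-unique : ∀ {n} rp q → n ∉ q → Unique (children n rp q)
children-unique rp []      n∉ = [] ∷ []
children-unique {n} rp (x ∷ q) n∉ = All.tabulate first≢ ∷ children-unique (x ∷ rp) q (n∉ ∘ there)
  where
  first≢ : ∀ {w} → w ∈ children n (x ∷ rp) q → rp ʳ++ n ∷ x ∷ q ≢ w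
  first≢ w∈ eq with p , s , refl , _ ← ∈-children⁻ (x ∷ rp) q w∈ = n∉ (here (Listₚ.∷-injectiveˡ (ʳ++-cancelˡ rp eq)))

erase : ℕ → List ℕ → List ℕ
erase n []      = []
erase n (x ∷ w) with n ℕₚ.≟ x
... | yes _ = w
... | no  _ = x ∷ erase n w

erase-inserted : ∀ {n} p {s} → n ∉ p → erase n (p ++ n ∷ s) ≡ p ++ s
erase-inserted {n} []      n∉ with n ℕₚ.≟ n
... | yes _   = refl
... | no  n≢n = contradiction refl n≢n
erase-inserted {n} (x ∷ p) n∉ with n ℕₚ.≟ x
... | yes refl = contradiction (here refl) n∉
... | no  _    = cong (x ∷_) (erase-inserted p (n∉ ∘ there))

-- `g` recovers the parent from each child, so different parents have disjoint lists of children.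
concatMap-unique : ∀ {A B : Set} (f : A → List B) (g : B → A) xs →
  (∀ {x y} → x ∈ xs → y ∈ f x → g y ≡ x) → (∀ {x} → x ∈ xs → Unique (f x)) → Unique xs → Unique (concatMap f xs)
concatMap-unique f g []       inv uniq _ = []
concatMap-unique f g (x ∷ xs) inv uniq (x≢ ∷ !xs) =
  Uniqueₚ.++⁺ (uniq (here refl)) (concatMap-unique f g xs (inv ∘ there) (uniq ∘ there) !xs) λ (y∈ , y∈′) →
    let x′ , x′∈ , y∈x′ = find (∈-concatMap⁻ f {xs = xs} y∈′) in
    All.lookup x≢ x′∈ (trans (sym (inv (here refl) y∈)) (inv (there x′∈) y∈x′))

words-unique : ∀ k n → Unique (words k n)
words-unique zero    n = [] ∷ []
words-unique (suc k) n = concatMap-unique _ behead (words k n)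
  (λ {w} _ y∈ → inverse w y∈) (λ _ → Uniqueₚ.map⁺ Listₚ.∷-injectiveˡ (Uniqueₚ.upTo⁺ n)) (words-unique k n)
  where
  behead : List ℕ → List ℕ
  behead []      = []
  behead (_ ∷ w) = w
  inverse : ∀ w {y} → y ∈ map (_∷ w) (upTo n) → behead y ≡ w
  inverse w y∈ with _ , _ , refl ← ∈-map⁻ (_∷ w) y∈ = refl

∈-words : ∀ {n} w → Below n w → w ∈ words (length w) n
∈-words []      []              = here refl
∈-words (x ∷ w) (x<n ∷ below) =
  ∈-concatMap⁺ _ (lose (∈-words w below) (∈-map⁺ (_∷ w) (∈-upTo⁺ x<n)))

record IsPerm (n : ℕ) (w : List ℕ) : Set where
  constructor isPerm
  field
    length≡  : length w ≡ n
    below    : Below n w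
    distinct : Unique w
open IsPerm

unique-resp-↭ : ∀ {xs ys : List ℕ} → xs ↭ ys → Unique xs → Unique ys
unique-resp-↭ p = ↭ₛ.Unique-resp-↭ (setoid ℕ) (↭⇒↭ₛ p)

isPerm-insert : ∀ {n} p {s} → IsPerm n (p ++ s) → IsPerm (suc n) (p ++ n ∷ s)
isPerm-insert {n} p {s} (isPerm len below dist) = isPerm
  (trans (↭-length (shift n p s)) (cong suc len))
  (All-resp-↭ (↭-sym (shift n p s)) (ℕₚ.n<1+n n ∷ All.map ℕₚ.m<n⇒m<1+n below))
  (unique-resp-↭ (↭-sym (shift n p s)) (All.map (≢-sym ∘ ℕₚ.<⇒≢) below ∷ dist))

remove-max : ∀ {n} p {s} → Below (suc n) (p ++ n ∷ s) → Unique (p ++ n ∷ s) → Below n (p ++ s) × Unique (p ++ s)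
remove-max {n} p {s} below dist
  with n≢ ∷ dist′ ← unique-resp-↭ (shift n p s) dist | _ ∷ below′ ← All-resp-↭ (shift n p s) below =
  All.zipWith (λ (n≢x , x<1+n) → ℕₚ.≤∧≢⇒< (ℕₚ.≤-pred x<1+n) (≢-sym n≢x)) (n≢ , below′) , dist′

-- Pigeonhole by removing the largest value if it occurs, and lowering the bound if it does not.
bounded-length : ∀ n {w} → Below n w → Unique w → length w ≤ n
without-max : ∀ n {w} → n ∉ w → Below (suc n) w → Unique w → length w ≤ n

bounded-length zero    []      _    = z≤n
bounded-length (suc n) {w} below dist with (ℕₚ._≟_ ∈? n) w
... | no n∉w = ℕₚ.m≤n⇒m≤1+n (without-max n n∉w below dist)
... | yes n∈w with p , s , refl ← ∈-∃++ n∈w with below′ , dist′ ← remove-max p below dist =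
  subst (_≤ suc n) (sym (↭-length (shift n p s))) (s≤s (bounded-length n below′ dist′))

without-max n n∉w below = bounded-length n
  (All.tabulate λ x∈ → ℕₚ.≤∧≢⇒< (ℕₚ.≤-pred (All.lookup below x∈)) λ { refl → n∉w x∈ })

perms-sound : ∀ n {w} → w ∈ perms n → IsPerm n w
perms-sound zero    (here refl) = isPerm refl [] []
perms-sound (suc n) w∈
  with v , v∈ , w∈v ← find (∈-concatMap⁻ (children n []) {xs = perms n} w∈)
  with p , s , refl , refl ← ∈-children⁻ [] v w∈v = isPerm-insert p (perms-sound n v∈)

perms-complete : ∀ n {w} → IsPerm n w → w ∈ perms n
perms-complete zero    {[]} _ = here refl
perms-complete (suc n) {w} (isPerm len below dist) with (ℕₚ._≟_ ∈? n) w
... | no n∉w = contradiction (subst (_≤ n) len (without-max n n∉w below dist)) ℕₚ.1+n≰n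
... | yes n∈w with p , s , refl ← ∈-∃++ n∈w with below′ , dist′ ← remove-max p below dist =
  ∈-concatMap⁺ (children n []) (lose (perms-complete n
    (isPerm (ℕₚ.suc-injective (trans (sym (↭-length (shift n p s))) len)) below′ dist′)) (∈-children⁺ p))

perms-fresh : ∀ n {w} → w ∈ perms n → n ∉ w
perms-fresh n w∈ n∈w = ℕₚ.<-irrefl refl (All.lookup (below (perms-sound n w∈)) n∈w)

perms-unique : ∀ n → Unique (perms n)
perms-unique zero    = [] ∷ []
perms-unique (suc n) = concatMap-unique (children n []) (erase n) (perms n)
  inverse (children-unique [] _ ∘ perms-fresh n) (perms-unique n)
  where
  inverse : ∀ {v w} → v ∈ perms n → w ∈ children n [] v → erase n w ≡ v
  inverse {v} v∈ w∈ with p , s , refl , refl ← ∈-children⁻ [] v w∈ =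
    erase-inserted p (perms-fresh n v∈ ∘ ∈-++⁺ˡ)

all-true⁻ : ∀ {A : Set} (f : A → Bool) xs → all f xs ≡ true → All (λ x → f x ≡ true) xs
all-true⁻ f []       _  = []
all-true⁻ f (x ∷ xs) eq with fx , eq′ ← ∧-true⁻ (f x) eq = fx ∷ all-true⁻ f xs eq′

all-true⁺ : ∀ {A : Set} (f : A → Bool) {xs} → All (λ x → f x ≡ true) xs → all f xs ≡ true
all-true⁺ f []         = refl
all-true⁺ f (fx ∷ fxs) rewrite fx = all-true⁺ f fxs

≡ᵇ-false⁻ : ∀ {x y} → not (x ≡ᵇ y) ≡ true → x ≢ y
≡ᵇ-false⁻ {x} eq refl rewrite Equivalence.to 𝔹ₚ.T-≡ (ℕₚ.≡⇒≡ᵇ x x refl) = contradiction eq λ ()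

≡ᵇ-false⁺ : ∀ {x y} → x ≢ y → not (x ≡ᵇ y) ≡ true
≡ᵇ-false⁺ {x} {y} x≢y with x ≡ᵇ y in eq
... | false = refl
... | true  = contradiction (ℕₚ.≡ᵇ⇒≡ x y (Equivalence.from 𝔹ₚ.T-≡ eq)) x≢y

distinctᵇ⁻ : ∀ w → distinctᵇ w ≡ true → Unique w
distinctᵇ⁻ []      _  = []
distinctᵇ⁻ (x ∷ w) eq with x≢ , eq′ ← ∧-true⁻ (all (λ y → not (x ≡ᵇ y)) w) eq =
  All.map ≡ᵇ-false⁻ (all-true⁻ _ w x≢) ∷ distinctᵇ⁻ w eq′

distinctᵇ⁺ : ∀ {w} → Unique w → distinctᵇ w ≡ true
distinctᵇ⁺ []         = refl
distinctᵇ⁺ {x ∷ w} (x≢ ∷ dist) rewrite all-true⁺ (λ y → not (x ≡ᵇ y)) (All.map ≡ᵇ-false⁺ x≢) = distinctᵇ⁺ dist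

isPermᵇ⁻ : ∀ n w → isPermᵇ n w ≡ true → IsPerm n w
isPermᵇ⁻ n w eq with len , eq′ ← ∧-true⁻ (length w ≡ᵇ n) eq with bnd , dist ← ∧-true⁻ (boundedᵇ n w) eq′ = isPerm
  (ℕₚ.≡ᵇ⇒≡ (length w) n (Equivalence.from 𝔹ₚ.T-≡ len))
  (All.map (<ᵇ-true⁻ _ n ∘ sym) (all-true⁻ _ w bnd))
  (distinctᵇ⁻ w dist)

isPermᵇ⁺ : ∀ {n w} → IsPerm n w → isPermᵇ n w ≡ true
isPermᵇ⁺ {n} {w} (isPerm len below dist)
  rewrite Equivalence.to 𝔹ₚ.T-≡ (ℕₚ.≡⇒≡ᵇ (length w) n len)
        | all-true⁺ (λ x → x <ᵇ n) (All.map <ᵇ-true below) = distinctᵇ⁺ dist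

avoiders : ℕ → List (List ℕ)
avoiders n = filter (λ w → avoids w 𝔹ₚ.≟ true) (perms n)

-- The lists are ordered differently, but both are free of repetitions and have the same members,
-- hence are rearrangements of each other.
countAv-avoiders : ∀ n → countAv (p4123 ∷ p1243 ∷ []) n ≡ length (avoiders n)
countAv-avoiders n = ↭-length (∼bag⇒↭ (unique∧set⇒bag
  (Uniqueₚ.filter⁺ P? (words-unique n n)) (Uniqueₚ.filter⁺ A? (perms-unique n)) (mk⇔ to from)))
  where
  P? = λ w → (isPermᵇ n w ∧ avoids w) 𝔹ₚ.≟ true
  A? = λ w → avoids w 𝔹ₚ.≟ true
  to : ∀ {w} → w ∈ filter P? (words n n) → w ∈ avoiders n
  to {w} w∈ with w∈words , ok ← ∈-filter⁻ P? {xs = words n n} w∈ with perm , good ← ∧-true⁻ (isPermᵇ n w) ok =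
    ∈-filter⁺ A? (perms-complete n (isPermᵇ⁻ n w perm)) good
  from : ∀ {w} → w ∈ avoiders n → w ∈ filter P? (words n n)
  from {w} w∈ with w∈perms , good ← ∈-filter⁻ A? {xs = perms n} w∈ with perm ← perms-sound n w∈perms =
    ∈-filter⁺ P? (subst (λ k → w ∈ words k n) (length≡ perm) (∈-words w (below perm)))
      (cong₂ _∧_ (isPermᵇ⁺ perm) good)

sum-concatMap : ∀ {A B : Set} (g : B → ℕ) (f : A → List B) xs →
  sum (map g (concatMap f xs)) ≡ sum (map (λ x → sum (map g (f x))) xs)
sum-concatMap g f []       = refl
sum-concatMap g f (x ∷ xs) = begin
  sum (map g (f x ++ concatMap f xs))                ≡⟨ cong sum (Listₚ.map-++ g (f x) _) ⟩
  sum (map g (f x) ++ map g (concatMap f xs))        ≡⟨ sum-++ (map g (f x)) _ ⟩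
  sum (map g (f x)) + sum (map g (concatMap f xs))   ≡⟨ cong₂ _+_ refl (sum-concatMap g f xs) ⟩
  sum (map g (f x)) + sum (map (λ x → sum (map g (f x))) xs) ∎
  where open ≡-Reasoning

sum-children : ∀ k n rp q → sum (map (descendants k (suc n)) (children n rp q)) ≡ child k n rp q + after (child k n) rp q
sum-children k n rp []      = refl
sum-children k n rp (x ∷ q) = cong₂ _+_ refl (sum-children k n (x ∷ rp) q)

sum-descendants : ∀ k n → sum (map (descendants k n) (perms n)) ≡ sum (map (descendants 0 0) (perms (k + n)))
sum-descendants zero    n = refl
sum-descendants (suc k) n = begin
  sum (map (descendants (suc k) n) (perms n))
    ≡⟨ cong sum (Listₚ.map-cong (λ w → sym (sum-children k n [] w)) (perms n)) ⟩
  sum (map (λ w → sum (map (descendants k (suc n)) (children n [] w))) (perms n))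
    ≡⟨ sum-concatMap (descendants k (suc n)) (children n []) (perms n) ⟨
  sum (map (descendants k (suc n)) (perms (suc n)))
    ≡⟨ sum-descendants k (suc n) ⟩
  sum (map (descendants 0 0) (perms (k + suc n)))
    ≡⟨ cong (λ m → sum (map (descendants 0 0) (perms m))) (ℕₚ.+-suc k n) ⟩
  sum (map (descendants 0 0) (perms (suc k + n))) ∎
  where open ≡-Reasoning

length-avoiders : ∀ ws → length (filter (λ w → avoids w 𝔹ₚ.≟ true) ws) ≡ sum (map (descendants 0 0) ws)
length-avoiders []       = refl
length-avoiders (w ∷ ws) with avoids w
... | true  = cong suc (length-avoiders ws)
... | false = length-avoiders ws

countAv-descendants : ∀ n → countAv (p4123 ∷ p1243 ∷ []) n ≡ descendants n 0 []
countAv-descendants n = begin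
  countAv (p4123 ∷ p1243 ∷ []) n                  ≡⟨ countAv-avoiders n ⟩
  length (avoiders n)                             ≡⟨ length-avoiders (perms n) ⟩
  sum (map (descendants 0 0) (perms n))           ≡⟨ cong (λ m → sum (map (descendants 0 0) (perms m))) (ℕₚ.+-identityʳ n) ⟨
  sum (map (descendants 0 0) (perms (n + 0)))     ≡⟨ sum-descendants n 0 ⟨
  descendants n 0 [] + 0                          ≡⟨ ℕₚ.+-identityʳ _ ⟩
  descendants n 0 []                              ∎
  where open ≡-Reasoning

-- The square root

open Identities (fromCommutativeRing PS-commutativeRing) const-morphism

embed : (ℕ → ℕ) → PS
embed f n = + f n

z u : PS
z zero    = + 0
z (suc n) = const (+ 1) n
u n = + 1

z-⊛-suc : ∀ f n → (z ⊛ f) (suc n) ≡ f n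
z-⊛-suc f n = trans (⊛-head z f n) (trans (ℤₚ.+-identityˡ _)
  (trans (const-⊛ (+ 1) f n) (ℤₚ.*-identityˡ (f n))))

infix 4 _≈[_]_
_≈[_]_ : PS → ℕ → PS → Set
f ≈[ n ] g = ∀ m → m < n → f m ≡ g m

≋⇒≈ : ∀ {f g n} → f ≋ g → f ≈[ n ] g
≋⇒≈ h m _ = h m

≈-trans : ∀ {f g h n} → f ≈[ n ] g → g ≈[ n ] h → f ≈[ n ] h
≈-trans p q m m<n = trans (p m m<n) (q m m<n)

≈-⊕ : ∀ {f f′ g g′ n} → f ≈[ n ] f′ → g ≈[ n ] g′ → f ⊕ g ≈[ n ] f′ ⊕ g′
≈-⊕ p q m m<n = cong₂ _+ℤ_ (p m m<n) (q m m<n)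

≈-⊛ : ∀ {f f′ g g′ n} → f ≈[ n ] f′ → g ≈[ n ] g′ → f ⊛ g ≈[ n ] f′ ⊛ g′
≈-⊛ p q m m<n = sumTo-cong m λ k k≤m →
  cong₂ _*ℤ_ (p k (ℕₚ.≤-<-trans k≤m m<n)) (q (m ∸ k) (ℕₚ.≤-<-trans (ℕₚ.m∸n≤m m k) m<n))

z-⊛-≈ : ∀ {f g n} → f ≈[ n ] g → z ⊛ f ≈[ suc n ] z ⊛ g
z-⊛-≈ h zero    _         = refl
z-⊛-≈ {f} {g} h (suc m) (s≤s m<n) = trans (z-⊛-suc f m) (trans (h m m<n) (sym (z-⊛-suc g m)))

u-inverse : (const (+ 1) - z) ⊛ u ≋ const (+ 1)
u-inverse = ≋-trans (solve 2 (λ z u → (con (+ 1) :- z) :* u := u :- z :* u) ≋-refl z u) difference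
  where
  difference : u - z ⊛ u ≋ const (+ 1)
  difference zero    = refl
  difference (suc n) = cong (λ x → + 1 +ℤ -ℤ x) (z-⊛-suc u n)

catalanIter : ℕ → PS
catalanIter zero    = const (+ 0)
catalanIter (suc j) = u ⊕ z ⊛ (catalanIter j ⊛ catalanIter j)

-- The limit of the iterates: coefficient n is final from iterate n + 1 on, as the square carries a
-- factor z. M is u C(z u) for the Catalan series C, with coefficients 1, 2, 5, 15, ..., the
-- binomial transform of the Catalan numbers.
M : PS
M n = catalanIter (suc n) n

catalanIter-stable : ∀ j → catalanIter j ≈[ j ] catalanIter (suc j)
catalanIter-stable zero    m ()
catalanIter-stable (suc j) = ≈-⊕ {u} (≋⇒≈ ≋-refl)
  (z-⊛-≈ (≈-⊛ {catalanIter j} (catalanIter-stable j) (catalanIter-stable j)))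

M≈catalanIter : ∀ j → M ≈[ j ] catalanIter j
M≈catalanIter (suc j) m (s≤s m≤j) with ℕₚ.m≤n⇒m<n∨m≡n m≤j
... | inj₁ m<j  = trans (M≈catalanIter j m m<j) (catalanIter-stable j m m<j)
... | inj₂ refl = refl

M-equation : M ≋ u ⊕ z ⊛ (M ⊛ M)
M-equation n = sym (≈-⊕ {u} (≋⇒≈ ≋-refl)
  (z-⊛-≈ (≈-⊛ {M} (M≈catalanIter n) (M≈catalanIter n))) n ℕₚ.≤-refl)

embed-+ : ∀ f g → embed (λ k → f k ℕ.+ g k) ≋ embed f ⊕ embed g
embed-+ f g n = ℤₚ.pos-+ (f n) (g n)

embed-step : ∀ (f g : ℕ → ℕ) → f 0 ≡ 1 → (∀ k → f (suc k) ≡ g k) → embed f ≋ const (+ 1) ⊕ z ⊛ embed g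
embed-step f g f₀ fₛ zero    = cong +_ f₀
embed-step f g f₀ fₛ (suc n) =
  trans (cong +_ (fₛ n)) (trans (sym (z-⊛-suc (embed g) n)) (sym (ℤₚ.+-identityˡ ((z ⊛ embed g) (suc n)))))

embed-0 : embed (λ _ → 0) ≋ const (+ 0)
embed-0 n = sym (const-0 n)

module GF = GeneratingFunctions
  (λ n f g → f ≈[ n ] g) z u M embed (λ _ ()) ≋⇒≈ ≈-trans
  (λ {x} {y} {v} {w} → ≈-⊕ {x} {y} {v} {w}) z-⊛-≈ u-inverse M-equation embed-0 embed-+ embed-step

poly-horner : ∀ ks → poly ks ≋ horner ks z
poly-horner []       n       = sym (const-0 n)
poly-horner (k ∷ ks) zero    = sym (ℤₚ.+-identityʳ k)
poly-horner (k ∷ ks) (suc n) = trans (poly-horner ks n)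
  (trans (sym (z-⊛-suc (horner ks z) n)) (sym (ℤₚ.+-identityˡ ((z ⊛ horner ks z) (suc n)))))

-- If f vanishes below n, coefficient n of the product is f n times g 0.
⊛-zero-cancelʳ : ∀ {f g} → g 0 ≢ + 0 → f ⊛ g ≋ const (+ 0) → f ≋ const (+ 0)
⊛-zero-cancelʳ {f} {g} g₀≢0 fg≋0 n = vanish (suc n) n ℕₚ.≤-refl
  where
  cancel : ∀ {x} → x *ℤ g 0 ≡ + 0 → x ≡ + 0
  cancel {x} eq with ℤₚ.i*j≡0⇒i≡0∨j≡0 x eq
  ... | inj₁ x≡0  = x≡0
  ... | inj₂ g₀≡0 = contradiction g₀≡0 g₀≢0
  coefficient : ∀ n → f ≈[ n ] const (+ 0) → f n *ℤ g 0 ≡ + 0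
  coefficient zero    _ = fg≋0 0
  coefficient (suc n) h = begin
    f (suc n) *ℤ g 0                          ≡⟨ ℤₚ.+-identityˡ _ ⟨
    + 0 +ℤ f (suc n) *ℤ g 0                   ≡⟨ cong (_+ℤ f (suc n) *ℤ g 0) previous ⟨
    (f ⊛ tail g) n +ℤ f (suc n) *ℤ g 0        ≡⟨ ⊛-last f g n ⟨
    (f ⊛ g) (suc n)                           ≡⟨ fg≋0 (suc n) ⟩
    + 0                                       ∎
    where
    open ≡-Reasoning
    previous : (f ⊛ tail g) n ≡ + 0
    previous = trans (≈-⊛ {f} {const (+ 0)} {tail g} h (λ _ _ → refl) n ℕₚ.≤-refl) (const-⊛ (+ 0) (tail g) n)
  vanish : ∀ n → f ≈[ n ] const (+ 0)
  vanish (suc n) m (s≤s m≤n) with ℕₚ.m≤n⇒m<n∨m≡n m≤n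
  ... | inj₁ m<n  = vanish n m m<n
  ... | inj₂ refl = trans (cancel (coefficient n (vanish n))) (sym (const-0 n))

-- (f - g)(f + g) = 0, and f + g has constant term 2.
√-unique : ∀ {f g} → f 0 ≡ + 1 → g 0 ≡ + 1 → f ⊛ f ≋ g ⊛ g → f ≋ g
√-unique {f} {g} f₀ g₀ eq = ≋-trans
  (solve 2 (λ f g → f := (f :- g) :+ g) ≋-refl f g)
  (≋-trans (λ n → cong (_+ℤ g n) (difference n))
    (solve 1 (λ g → con (+ 0) :+ g := g) ≋-refl g))
  where
  difference : f - g ≋ const (+ 0)
  difference = ⊛-zero-cancelʳ {f - g} {f ⊕ g}
    (λ sum₀ → contradiction (trans (sym sum₀) (cong₂ _+ℤ_ f₀ g₀)) λ ())
    (≋-trans (solve 2 (λ f g → (f :- g) :* (f :+ g) := f :* f :- g :* g) ≋-refl f g) (≈⇒-≈0 eq))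

P₂-embed : P₂ ≋ const (+ 1) ⊕ z ⊛ embed (λ k → treeA k 0 0 0)
P₂-embed = embed-step (countAv (p4123 ∷ p1243 ∷ [])) (λ k → treeA k 0 0 0) refl
  (λ k → trans (countAv-descendants (suc k)) (descendants-root k))

theorem1p2 : (S : PS) → S 0 ≡ + 1
    → S ⊛ S ≋ poly (+ 1 ∷ -[1+ 5 ] ∷ + 5 ∷ [])
    → poly (+ 0 ∷ + 2 ∷ []) ⊛ poly (+ 2 ∷ -[1+ 0 ] ∷ []) ⊛ poly (+ 2 ∷ -[1+ 0 ] ∷ [])
    ⊛ poly (+ 1 ∷ -[1+ 1 ] ∷ []) ⊛ poly (+ 1 ∷ -[1+ 2 ] ∷ + 1 ∷ []) ⊛ P₂
    ≋ poly (+ 2 ∷ -[1+ 7 ] ∷ + 2 ∷ + 17 ∷ -[1+ 14 ] ∷ + 4 ∷ [])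
    ⊖ poly (+ 2 ∷ -[1+ 9 ] ∷ + 16 ∷ -[1+ 8 ] ∷ + 2 ∷ []) ⊛ S
theorem1p2 S S₀ S² = ≋-trans
  (⊛-cong (⊛-cong (⊛-cong (⊛-cong (⊛-cong (p (+ 0 ∷ + 2 ∷ [])) (p (+ 2 ∷ -[1+ 0 ] ∷ []))) (p (+ 2 ∷ -[1+ 0 ] ∷ [])))
    (p (+ 1 ∷ -[1+ 1 ] ∷ []))) (p (+ 1 ∷ -[1+ 2 ] ∷ + 1 ∷ []))) (≋-refl {P₂}))
  (≋-trans (closed-form z u M (embed (λ k → treeA k 0 0 0)) P₂ S u-inverse M-equation
      -- Agreement up to order n + 1 is the first to include coefficient n.
      (λ n → GF.treeA-closed (suc n) 0 0 0 n ℕₚ.≤-refl) P₂-embed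
      (√-unique S₀ refl (≋-trans S² (≋-trans (p (+ 1 ∷ -[1+ 5 ] ∷ + 5 ∷ []))
        (≋-sym (√-square z u M u-inverse M-equation))))))
    (≋-sym (λ n → cong₂ (λ x y → x +ℤ -ℤ y) (p (+ 2 ∷ -[1+ 7 ] ∷ + 2 ∷ + 17 ∷ -[1+ 14 ] ∷ + 4 ∷ []) n)
      (⊛-cong (p (+ 2 ∷ -[1+ 9 ] ∷ + 16 ∷ -[1+ 8 ] ∷ + 2 ∷ [])) (≋-refl {S}) n))))
  where p = poly-horner
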